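{- $t(K(10,4))=\frac{3}{2}$. Moreover, if $S$ is a vertex cut of $K(10,4)$ such that $\frac{|S|}{c(K(10,4)\setminus S)} = \frac{3}{2}$, then $S$ is the complement of a maximum independent set of $K(10,4)$.
   Context: The Kneser graph $K(n,k)$ has as vertices the $k$-element subsets of $[n]=\{1,\dots,n\}$, two vertices adjacent iff the subsets are disjoint. A vertex cut is a set $S$ of vertices whose removal disconnects the graph; $c(G\setminus S)$ is the number of connected components after deleting $S$; the toughness is $t(G)=\min_S |S|/c(G\setminus S)$ over all vertex cuts $S$. -}

module Defs where

open import Data.Nat using (ℕ; _≤_)
open import Data.Fin.Subset using (Subset; _∩_; ⊥; ∣_∣)
open import Data.List using (List; length)
open import Data.List.Membership.Propositional using () renaming (_∈_ to _∈ₗ_; _∉_ to _∉ₗ_)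
open import Data.List.Relation.Unary.All using (All)
open import Data.List.Relation.Unary.Any using (Any)
open import Data.List.Relation.Unary.AllPairs using (AllPairs)
open import Data.List.Relation.Unary.Unique.Propositional using (Unique)
open import Data.Product using (_×_; ∃)
open import Relation.Binary.PropositionalEquality using (_≡_)
open import Relation.Nullary using (¬_)

module Kneser (n k : ℕ) where

  IsVertex : Subset n → Set
  IsVertex s = ∣ s ∣ ≡ k

  Adj : Subset n → Subset n → Set
  Adj u v = u ∩ v ≡ ⊥

  IsVertexSet : List (Subset n) → Set
  IsVertexSet S = All IsVertex S × Unique S

  Remaining : List (Subset n) → Subset n → Set
  Remaining S v = IsVertex v × v ∉ₗ S

  data Connected (S : List (Subset n)) (u : Subset n) : Subset n → Set where
    here : Remaining S u → Connected S u u
    step : ∀ {w v} → Connected S u w → Adj w v → Remaining S v → Connected S u v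

  NumComponents : List (Subset n) → ℕ → Set
  NumComponents S c =
    ∃ λ (reps : List (Subset n)) →
      length reps ≡ c
      × All (Remaining S) reps
      × AllPairs (λ a b → ¬ Connected S a b) reps
      × (∀ v → Remaining S v → Any (λ r → Connected S r v) reps)

  IsCutWith : List (Subset n) → ℕ → Set
  IsCutWith S c = IsVertexSet S × NumComponents S c × 2 ≤ c

  IsIndependent : List (Subset n) → Set
  IsIndependent I = IsVertexSet I × AllPairs (λ a b → ¬ Adj a b) I

  IsMaxIndependent : List (Subset n) → Set
  IsMaxIndependent I =
    IsIndependent I × (∀ J → IsIndependent J → length J ≤ length I)

  IsComplementOf : List (Subset n) → List (Subset n) → Set
  IsComplementOf S I =
    IsVertexSet S × (∀ v → IsVertex v → (v ∈ₗ S → v ∉ₗ I) × (v ∉ₗ I → v ∈ₗ S))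

{-# OPTIONS --safe #-}

-- The adjacency matrix of K(10,4) has least eigenvalue −10, so ∑ y(u) y(v) + 10 ∑ y(v)² ≥ 0 for
-- every integer vector y, where the first sum is over the ordered edges.  Let the components of the
-- graph without S have h_i vertices and w_i inner ordered edges, and put y = β_i − 2 on the i-th
-- component and y = −2 on S, with β_i = 5 if h_i ≤ 2 and β_i = 2 otherwise.  As distinct components
-- are not adjacent, the inequality becomes
--   100 |S| ≥ ∑ (100 (β_i − 1) h_i − β_i² (w_i + 10 h_i)).
-- Every summand is at least 150, with equality only for h_i = 1; for h_i ≥ 3 this holds because at
-- least 38 edges leave the component.  Hence |S| ≥ 3c/2, and in the case of equality the complement
-- of S is an independent set of 84 vertices.  Complements of independent sets are cuts into
-- singletons, so the same bound shows that no independent set is larger.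
--
-- The eigenvalue bound is the sum of the corresponding bounds for the 945 Petersen subgraphs coming
-- from perfect matchings of the ten points.  The bound on edges leaving a component follows from
-- joining all pairs of vertices by walks of length at most 3 that together use every ordered edge
-- at most 36 times.

module Submission where

open import Defs
open Kneser 10 4

open import Data.Bool using (Bool; true; false; not; _∧_; _xor_; T)
import Data.Bool.Properties as Bool
open import Data.Bool.Properties using (T-∧; T-≡)
import Data.Empty as Empty
open import Data.Empty using (⊥-elim)
open import Data.Fin as Fin using (Fin; zero; suc)
open import Data.Fin.Patterns
import Data.Fin.Properties as Fin
open import Data.Fin.Subset using (Subset; inside; outside; _∩_; _∪_; ∁; ∣_∣; ⊥; ⁅_⁆)
open import Data.Fin.Subset.Properties using (∩-comm; ∩-idem; ∣⊥∣≡0)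
open import Data.Integer
  using (ℤ; +_; -[1+_]; -_; _+_; _-_; _*_; _≤_; 0ℤ; 1ℤ; +≤+; +<+; nonNegative)
open import Data.Integer.Properties
open import Data.Integer.Tactic.RingSolver using (solve-∀; solve)
open import Data.List as List
  using (List; module List; []; _∷_; _++_; map; concatMap; filter; foldr; length; allFin)
open import Data.List.Membership.Propositional using (_∈_; _∉_; find; lose)
open import Data.List.Membership.Propositional.Properties
open import Data.List.Properties using (length-tabulate)
open import Data.List.Relation.Unary.All as All using (All; []; _∷_)
open import Data.List.Relation.Unary.AllPairs as AllPairs using (AllPairs; []; _∷_)
open import Data.List.Relation.Unary.Any using (Any; here; there; index)
open import Data.List.Relation.Unary.Any.Properties using (lookup-index)
open import Data.List.Relation.Unary.Unique.Propositional using (Unique)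
import Data.List.Relation.Unary.Unique.Propositional.Properties as Unique
open import Data.Maybe using (Maybe; just; nothing; is-nothing)
open import Data.Nat as ℕ using (ℕ; zero; suc; z≤n; s≤s)
import Data.Nat.Properties as ℕ
open import Data.Product using (_×_; _,_; proj₁; proj₂; swap; ∃; ∃₂)
open import Data.Sum using (_⊎_; inj₁; inj₂)
open import Data.Vec as Vec using (Vec; []; _∷_)
import Data.Vec.Properties as Vec
open import Function using (_∘_; id; Equivalence)
open import Level using (Level)
open import Relation.Binary using (DecidableEquality)
open import Relation.Binary.PropositionalEquality
open import Relation.Nullary using (¬_; Dec; yes; no; does)
open import Relation.Nullary.Decidable using (dec-true; dec-false; ¬?; _×-dec_; decidable-stable)
open import Relation.Unary using (Pred; Decidable)

-- Finite sums of integers over lists.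

private variable
  a b p : Level
  A : Set a
  B : Set b

∑ : List A → (A → ℤ) → ℤ
∑ []       f = 0ℤ
∑ (x ∷ xs) f = f x + ∑ xs f

∑-cong-∈ : ∀ (xs : List A) {f g : A → ℤ} → (∀ {x} → x ∈ xs → f x ≡ g x) → ∑ xs f ≡ ∑ xs g
∑-cong-∈ []       eq = refl
∑-cong-∈ (x ∷ xs) eq = cong₂ _+_ (eq (here refl)) (∑-cong-∈ xs (eq ∘ there))

∑-cong : ∀ (xs : List A) {f g : A → ℤ} → (∀ x → f x ≡ g x) → ∑ xs f ≡ ∑ xs g
∑-cong xs eq = ∑-cong-∈ xs λ {x} _ → eq x

∑-mono-∈ : ∀ (xs : List A) {f g : A → ℤ} → (∀ {x} → x ∈ xs → f x ≤ g x) → ∑ xs f ≤ ∑ xs g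
∑-mono-∈ []       le = ≤-refl
∑-mono-∈ (x ∷ xs) le = +-mono-≤ (le (here refl)) (∑-mono-∈ xs (le ∘ there))

∑-mono : ∀ (xs : List A) {f g : A → ℤ} → (∀ x → f x ≤ g x) → ∑ xs f ≤ ∑ xs g
∑-mono xs le = ∑-mono-∈ xs λ {x} _ → le x

∑-zero : ∀ (xs : List A) → ∑ xs (λ _ → 0ℤ) ≡ 0ℤ
∑-zero []       = refl
∑-zero (x ∷ xs) = trans (+-identityˡ _) (∑-zero xs)

∑-nonneg : ∀ (xs : List A) {f : A → ℤ} → (∀ x → 0ℤ ≤ f x) → 0ℤ ≤ ∑ xs f
∑-nonneg xs le = ≤-trans (≤-reflexive (sym (∑-zero xs))) (∑-mono xs le)

∑-one : ∀ (xs : List A) → ∑ xs (λ _ → 1ℤ) ≡ + length xs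
∑-one []       = refl
∑-one (x ∷ xs) = cong (_+_ 1ℤ) (∑-one xs)

∑-++ : ∀ (xs ys : List A) (f : A → ℤ) → ∑ (xs ++ ys) f ≡ ∑ xs f + ∑ ys f
∑-++ []       ys f = sym (+-identityˡ _)
∑-++ (x ∷ xs) ys f = trans (cong (_+_ (f x)) (∑-++ xs ys f)) (sym (+-assoc (f x) _ _))

∑-map : ∀ (xs : List A) (h : A → B) (f : B → ℤ) → ∑ (map h xs) f ≡ ∑ xs (f ∘ h)
∑-map []       h f = refl
∑-map (x ∷ xs) h f = cong (_+_ (f (h x))) (∑-map xs h f)

∑-concatMap : ∀ (xs : List A) (h : A → List B) (f : B → ℤ) →
              ∑ (concatMap h xs) f ≡ ∑ xs (λ x → ∑ (h x) f)
∑-concatMap []       h f = refl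
∑-concatMap (x ∷ xs) h f =
  trans (∑-++ (h x) (concatMap h xs) f) (cong (_+_ (∑ (h x) f)) (∑-concatMap xs h f))

∑-+ : ∀ (xs : List A) (f g : A → ℤ) → ∑ xs (λ x → f x + g x) ≡ ∑ xs f + ∑ xs g
∑-+ []       f g = refl
∑-+ (x ∷ xs) f g = trans (cong (_+_ (f x + g x)) (∑-+ xs f g)) (lemma (f x) (g x) (∑ xs f) (∑ xs g))
  where
  lemma : ∀ a b c d → a + b + (c + d) ≡ a + c + (b + d)
  lemma = solve-∀

∑-*ˡ : ∀ (xs : List A) (k : ℤ) (f : A → ℤ) → ∑ xs (λ x → k * f x) ≡ k * ∑ xs f
∑-*ˡ []       k f = sym (*-zeroʳ k)
∑-*ˡ (x ∷ xs) k f = trans (cong (_+_ (k * f x)) (∑-*ˡ xs k f)) (sym (*-distribˡ-+ k (f x) _))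

∑-*ʳ : ∀ (xs : List A) (k : ℤ) (f : A → ℤ) → ∑ xs (λ x → f x * k) ≡ ∑ xs f * k
∑-*ʳ xs k f = trans (∑-cong xs λ x → *-comm (f x) k) (trans (∑-*ˡ xs k f) (*-comm k _))

∑-const : ∀ (xs : List A) (k : ℤ) → ∑ xs (λ _ → k) ≡ k * + length xs
∑-const xs k = trans (∑-cong xs λ _ → sym (*-identityʳ k))
                     (trans (∑-*ˡ xs k (λ _ → 1ℤ)) (cong (k *_) (∑-one xs)))

∑-swap : ∀ (xs : List A) (ys : List B) (f : A → B → ℤ) →
         ∑ xs (λ x → ∑ ys (f x)) ≡ ∑ ys (λ y → ∑ xs (λ x → f x y))
∑-swap []       ys f = sym (∑-zero ys)
∑-swap (x ∷ xs) ys f =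
  trans (cong (_+_ (∑ ys (f x))) (∑-swap xs ys f)) (sym (∑-+ ys (f x) (λ y → ∑ xs (λ x → f x y))))

∑-member : ∀ {xs : List A} {f : A → ℤ} → (∀ x → 0ℤ ≤ f x) → ∀ {x} → x ∈ xs → f x ≤ ∑ xs f
∑-member {xs = y ∷ xs} {f} 0≤f (here refl) =
  subst (_≤ f y + ∑ xs f) (+-identityʳ _) (+-monoʳ-≤ (f y) (∑-nonneg xs 0≤f))
∑-member {xs = y ∷ xs} {f} 0≤f {x} (there x∈) =
  subst (_≤ f y + ∑ xs f) (+-identityˡ _) (+-mono-≤ (0≤f y) (∑-member 0≤f x∈))

ι : Bool → ℤ
ι true  = 1ℤ
ι false = 0ℤ

ι-nonneg : ∀ b → 0ℤ ≤ ι b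
ι-nonneg true  = +≤+ z≤n
ι-nonneg false = ≤-refl

ι-idem : ∀ b → ι b * ι b ≡ ι b
ι-idem true  = refl
ι-idem false = refl

∑-delta-∉ : (_≟_ : DecidableEquality A) (f : A → ℤ) {y : A} {xs : List A} →
            All (λ x → ¬ y ≡ x) xs → ∑ xs (λ x → ι (does (x ≟ y)) * f x) ≡ 0ℤ
∑-delta-∉ _≟_ f             []         = refl
∑-delta-∉ _≟_ f {y} {x ∷ xs} (y≢x ∷ ps) =
  trans (cong (λ d → ι d * f x + ∑ xs (λ x → ι (does (x ≟ y)) * f x))
              (dec-false (x ≟ y) (y≢x ∘ sym)))
        (trans (+-identityˡ _) (∑-delta-∉ _≟_ f ps))

∑-delta : (_≟_ : DecidableEquality A) (f : A → ℤ) {y : A} {xs : List A} →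
          Unique xs → y ∈ xs → ∑ xs (λ x → ι (does (x ≟ y)) * f x) ≡ f y
∑-delta _≟_ f {y} {x ∷ xs} (x∉ ∷ u) (here refl) =
  trans (cong₂ (λ d r → ι d * f x + r) (dec-true (x ≟ x) refl) (∑-delta-∉ _≟_ f x∉))
        (trans (+-identityʳ _) (*-identityˡ (f x)))
∑-delta _≟_ f {y} {x ∷ xs} (x∉ ∷ u) (there y∈) =
  trans (cong (λ d → ι d * f x + ∑ xs (λ x → ι (does (x ≟ y)) * f x))
              (dec-false (x ≟ y) (All.lookup x∉ y∈)))
        (trans (+-identityˡ _) (∑-delta _≟_ f u y∈))

∑-filter-≤ : {P : Pred A p} (P? : Decidable P) {f : A → ℤ} → (∀ x → 0ℤ ≤ f x) →
             ∀ xs → ∑ (filter P? xs) f ≤ ∑ xs f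
∑-filter-≤ P? 0≤f [] = ≤-refl
∑-filter-≤ P? {f} 0≤f (x ∷ xs) with does (P? x)
... | true  = +-monoʳ-≤ (f x) (∑-filter-≤ P? 0≤f xs)
... | false = subst (_≤ f x + ∑ xs f) (+-identityˡ _) (+-mono-≤ (0≤f x) (∑-filter-≤ P? 0≤f xs))

-- Applied to the filter that defines the neighbours of a vertex, which rejects the vertex itself.
∑-filter-< : {P : Pred A p} (P? : Decidable P) {f : A → ℤ} → (∀ x → 0ℤ ≤ f x) →
             ∀ {xs y} → y ∈ xs → ¬ P y → f y + ∑ (filter P? xs) f ≤ ∑ xs f
∑-filter-< P? {f} 0≤f {x ∷ xs} (here refl) ¬P with P? x
... | yes Px = ⊥-elim (¬P Px)
... | no  _  = +-monoʳ-≤ (f x) (∑-filter-≤ P? 0≤f xs)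
∑-filter-< P? {f} 0≤f {x ∷ xs} {y} (there y∈) ¬P with does (P? x)
... | true  = subst (_≤ f x + ∑ xs f) (lemma (f y) (f x) _)
                (+-monoʳ-≤ (f x) (∑-filter-< P? 0≤f y∈ ¬P))
  where
  lemma : ∀ a b c → b + (a + c) ≡ a + (b + c)
  lemma = solve-∀
... | false = subst (_≤ f x + ∑ xs f) (+-identityˡ _) (+-mono-≤ (0≤f x) (∑-filter-< P? 0≤f y∈ ¬P))

-- Multisets of bit vectors are compared by evaluating their tries of multiplicities.

data Trie : ℕ → Set where
  nil  : ∀ {n} → Trie n
  leaf : ℕ → Trie 0
  node : ∀ {n} → Trie n → Trie n → Trie (suc n)

insert : ∀ {n} → Vec Bool n → Trie n → Trie n
insert []          nil        = leaf 1
insert []          (leaf k)   = leaf (suc k)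
insert (true ∷ v)  nil        = node (insert v nil) nil
insert (false ∷ v) nil        = node nil (insert v nil)
insert (true ∷ v)  (node s t) = node (insert v s) t
insert (false ∷ v) (node s t) = node s (insert v t)

trie : ∀ {n} → List (Vec Bool n) → Trie n
trie = foldr insert nil

total : ∀ {n} → Trie n → (Vec Bool n → ℤ) → ℤ
total nil        f = 0ℤ
total (leaf k)   f = + k * f []
total (node s t) f = total s (f ∘ (true ∷_)) + total t (f ∘ (false ∷_))

total-insert : ∀ {n} (v : Vec Bool n) t f → total (insert v t) f ≡ f v + total t f
total-insert [] nil f = trans (*-identityˡ (f [])) (sym (+-identityʳ _))
total-insert [] (leaf k) f =
  trans (*-distribʳ-+ (f []) 1ℤ (+ k)) (cong (λ s → s + + k * f []) (*-identityˡ (f [])))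
total-insert (true ∷ v) nil f =
  trans (+-identityʳ _) (total-insert v nil (f ∘ (true ∷_)))
total-insert (false ∷ v) nil f =
  trans (+-identityˡ _) (total-insert v nil (f ∘ (false ∷_)))
total-insert (true ∷ v) (node s t) f =
  trans (cong (λ r → r + _) (total-insert v s (f ∘ (true ∷_)))) (+-assoc (f (true ∷ v)) _ _)
total-insert (false ∷ v) (node s t) f =
  trans (cong (_+_ (total s (f ∘ (true ∷_)))) (total-insert v t (f ∘ (false ∷_))))
        (lemma (total s (f ∘ (true ∷_))) (f (false ∷ v)) _)
  where
  lemma : ∀ a b c → a + (b + c) ≡ b + (a + c)
  lemma = solve-∀

total-trie : ∀ {n} (vs : List (Vec Bool n)) f → total (trie vs) f ≡ ∑ vs f
total-trie []       f = refl
total-trie (v ∷ vs) f = trans (total-insert v (trie vs) f) (cong (_+_ (f v)) (total-trie vs f))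

-- Tries built by `insert` have neither zero leaves nor nodes with two empty branches. Their shape
-- is therefore determined by the support, and for positive `k` unequal shapes may be rejected
-- outright.
multiple : ∀ {n} → ℕ → Trie n → Trie n → Bool
multiple k nil        nil          = true
multiple k (leaf a)   (leaf b)     = a ℕ.≡ᵇ k ℕ.* b
multiple k (node s t) (node s′ t′) = multiple k s s′ ∧ multiple k t t′
multiple k _          _            = false

multiple-total : ∀ {n} k (s t : Trie n) f → T (multiple k s t) → total s f ≡ + k * total t f
multiple-total k nil nil f _ = sym (*-zeroʳ (+ k))
multiple-total k (leaf a) (leaf b) f ok =
  trans (cong (λ m → + m * f []) (ℕ.≡ᵇ⇒≡ a (k ℕ.* b) ok))
        (trans (cong (_* f []) (pos-* k b)) (*-assoc (+ k) (+ b) (f [])))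
multiple-total k (node s t) (node s′ t′) f ok with Equivalence.to T-∧ ok
... | ok₁ , ok₂ = trans
  (cong₂ _+_ (multiple-total k s s′ _ ok₁) (multiple-total k t t′ _ ok₂))
  (sym (*-distribˡ-+ (+ k) (total s′ _) _))

within : ∀ {n} → ℕ → Trie n → Trie n → Bool
within k nil        _            = true
within k (leaf a)   (leaf b)     = a ℕ.≤ᵇ k ℕ.* b
within k (node s t) (node s′ t′) = within k s s′ ∧ within k t t′
within k _          nil          = false

total-nonneg : ∀ {n} (t : Trie n) {f} → (∀ v → 0ℤ ≤ f v) → 0ℤ ≤ total t f
total-nonneg nil        0≤f = ≤-refl
total-nonneg (leaf k) {f} 0≤f =
  subst (_≤ + k * f []) (*-zeroʳ (+ k)) (*-monoˡ-≤-nonNeg (+ k) (0≤f []))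
total-nonneg (node s t) 0≤f = +-mono-≤ (total-nonneg s (0≤f ∘ _)) (total-nonneg t (0≤f ∘ _))

-- Nonnegative values make smaller multiplicities give smaller totals, and vectors missing from `s`
-- only add to the right-hand side.
within-total : ∀ {n} k (s t : Trie n) {f} → (∀ v → 0ℤ ≤ f v) → T (within k s t) →
               total s f ≤ + k * total t f
within-total k nil t {f} 0≤f _ =
  subst (_≤ + k * total t f) (*-zeroʳ (+ k)) (*-monoˡ-≤-nonNeg (+ k) (total-nonneg t 0≤f))
within-total k (leaf a) (leaf b) {f} 0≤f ok =
  subst (+ a * f [] ≤_) (trans (cong (_* f []) (pos-* k b)) (*-assoc (+ k) (+ b) (f [])))
    (*-monoʳ-≤-nonNeg (f []) {{nonNegative (0≤f [])}} (+≤+ (ℕ.≤ᵇ⇒≤ a (k ℕ.* b) ok)))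
within-total k (node s t) (node s′ t′) 0≤f ok with Equivalence.to T-∧ ok
... | ok₁ , ok₂ = ≤-trans
  (+-mono-≤ (within-total k s s′ (0≤f ∘ _) ok₁) (within-total k t t′ (0≤f ∘ _) ok₂))
  (≤-reflexive (sym (*-distribˡ-+ (+ k) (total s′ _) _)))

∑-multiple : ∀ {n} k (us vs : List (Vec Bool n)) → multiple k (trie us) (trie vs) ≡ true →
             ∀ f → ∑ us f ≡ + k * ∑ vs f
∑-multiple k us vs ok f = trans (sym (total-trie us f))
  (trans (multiple-total k (trie us) (trie vs) f (Equivalence.from T-≡ ok))
         (cong (+ k *_) (total-trie vs f)))

∑-within : ∀ {n} k (us vs : List (Vec Bool n)) → within k (trie us) (trie vs) ≡ true →
           ∀ {f} → (∀ v → 0ℤ ≤ f v) → ∑ us f ≤ + k * ∑ vs f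
∑-within k us vs ok {f} 0≤f = subst₂ (λ x y → x ≤ + k * y) (total-trie us f) (total-trie vs f)
  (within-total k (trie us) (trie vs) 0≤f (Equivalence.from T-≡ ok))

key : ∀ {m n} → Vec Bool m × Vec Bool n → Vec Bool (m ℕ.+ n)
key (u , v) = u Vec.++ v

-- Functions on edges have to act on the concatenated keys stored in tries. Cutting the key by
-- recursion on `m` lets `unkey-key` hold by computation at each bit.
unkey : ∀ {m n} → (Vec Bool m × Vec Bool n → ℤ) → Vec Bool (m ℕ.+ n) → ℤ
unkey {zero}  f w       = f ([] , w)
unkey {suc m} f (b ∷ w) = unkey {m} (λ (u , v) → f (b ∷ u , v)) w

unkey-key : ∀ {m n} (f : Vec Bool m × Vec Bool n → ℤ) e → unkey {m} f (key e) ≡ f e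
unkey-key f ([] , v)    = refl
unkey-key f (b ∷ u , v) = unkey-key (λ (u , v) → f (b ∷ u , v)) (u , v)

unkey-nonneg : ∀ {m n} (f : Vec Bool m × Vec Bool n → ℤ) → (∀ e → 0ℤ ≤ f e) →
               ∀ w → 0ℤ ≤ unkey {m} f w
unkey-nonneg {zero}  f 0≤f w       = 0≤f _
unkey-nonneg {suc m} f 0≤f (b ∷ w) = unkey-nonneg {m} _ (λ _ → 0≤f _) w

∑-key : ∀ {m n} (es : List (Vec Bool m × Vec Bool n)) f → ∑ (map key es) (unkey {m} f) ≡ ∑ es f
∑-key es f = trans (∑-map es key _) (∑-cong es (unkey-key f))

-- Subsets of fixed size, and the vertices and edges of K(10,4).

witness : (A? : Dec A) → does A? ≡ true → A
witness (yes a) _ = a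

subsets : ∀ n → ℕ → List (Subset n)
subsets zero    zero    = [] ∷ []
subsets zero    (suc k) = []
subsets (suc n) zero    = map (outside ∷_) (subsets n zero)
subsets (suc n) (suc k) = map (inside ∷_) (subsets n k) ++ map (outside ∷_) (subsets n (suc k))

∈-subsets : ∀ {n k} (s : Subset n) → ∣ s ∣ ≡ k → s ∈ subsets n k
∈-subsets         []            refl = here refl
∈-subsets {k = zero}  (outside ∷ s) eq = ∈-map⁺ _ (∈-subsets s eq)
∈-subsets {k = suc k} (outside ∷ s) eq =
  ∈-++⁺ʳ (map (inside ∷_) (subsets _ k)) (∈-map⁺ _ (∈-subsets s eq))
∈-subsets {k = suc k} (inside ∷ s)  eq = ∈-++⁺ˡ (∈-map⁺ _ (∈-subsets s (ℕ.suc-injective eq)))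

subsets-size : ∀ n k {s} → s ∈ subsets n k → ∣ s ∣ ≡ k
subsets-size zero zero (here refl) = refl
subsets-size (suc n) zero s∈ with ∈-map⁻ _ s∈
... | t , t∈ , refl = subsets-size n zero t∈
subsets-size (suc n) (suc k) s∈ with ∈-++⁻ (map (inside ∷_) (subsets n k)) s∈
subsets-size (suc n) (suc k) s∈ | inj₁ t∈ with ∈-map⁻ _ t∈
... | t , t∈ , refl = cong suc (subsets-size n k t∈)
subsets-size (suc n) (suc k) s∈ | inj₂ t∈ with ∈-map⁻ _ t∈
... | t , t∈ , refl = subsets-size n (suc k) t∈

subsets-unique : ∀ n k → Unique (subsets n k)
subsets-unique zero    zero    = [] ∷ []
subsets-unique zero    (suc k) = []
subsets-unique (suc n) zero    = Unique.map⁺ Vec.∷-injectiveʳ (subsets-unique n zero)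
subsets-unique (suc n) (suc k) = Unique.++⁺
  (Unique.map⁺ Vec.∷-injectiveʳ (subsets-unique n k))
  (Unique.map⁺ Vec.∷-injectiveʳ (subsets-unique n (suc k)))
  λ (p , q) → disjoint (∈-map⁻ _ p) (∈-map⁻ _ q)
  where
  disjoint : ∀ {v} → ∃ (λ s → s ∈ subsets n k × v ≡ inside ∷ s) →
             ∃ (λ t → t ∈ subsets n (suc k) × v ≡ outside ∷ t) → Empty.⊥
  disjoint (_ , _ , refl) (_ , _ , ())

_≟ₛ_ : ∀ {n} → DecidableEquality (Subset n)
_≟ₛ_ = Vec.≡-dec Bool._≟_

open import Data.List.Membership.DecPropositional (_≟ₛ_ {10}) using (_∈?_)

adj? : ∀ u v → Dec (Adj u v)
adj? u v = (u ∩ v) ≟ₛ ⊥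

-- Opaque, so that the list of 210 vertices stays folded in symbolic arguments; outside this block
-- only the finite checks unfold it.
opaque
  vertices : List (Subset 10)
  vertices = subsets 10 4

  ∈-vertices⁺ : ∀ {v} → IsVertex v → v ∈ vertices
  ∈-vertices⁺ {v} = ∈-subsets v

  ∈-vertices⁻ : ∀ {v} → v ∈ vertices → IsVertex v
  ∈-vertices⁻ = subsets-size 10 4

  vertices-unique : Unique vertices
  vertices-unique = subsets-unique 10 4

  ∣vertices∣ : length vertices ≡ 210
  ∣vertices∣ = refl

neighbours : Subset 10 → List (Subset 10)
neighbours u = filter (adj? u) vertices

edges : List (Subset 10 × Subset 10)
edges = concatMap (λ u → map (u ,_) (neighbours u)) vertices

∈-edges⁻ : ∀ {u v} → (u , v) ∈ edges → u ∈ vertices × v ∈ vertices × Adj u v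
∈-edges⁻ e∈ with find (∈-concatMap⁻ (λ u → map (u ,_) (neighbours u)) {xs = vertices} e∈)
... | w , w∈ , e∈′ with ∈-map⁻ (w ,_) e∈′
... | _ , v∈ , refl with ∈-filter⁻ (adj? w) v∈
... | v∈′ , a = w∈ , v∈′ , a

opaque
  unfolding vertices

  -- A neighbour is one of the 15 four-element subsets of the six points outside `u`.
  regular : All (λ u → length (neighbours u) ≡ 15) vertices
  regular = witness (All.all? (λ u → length (neighbours u) ℕ.≟ 15) vertices) refl

∑-edges : ∀ f → ∑ edges f ≡ ∑ vertices (λ u → ∑ (neighbours u) (λ v → f (u , v)))
∑-edges f = trans (∑-concatMap vertices _ f) (∑-cong vertices λ u → ∑-map (neighbours u) (u ,_) f)

∑-edges-source : ∀ f → ∑ edges (f ∘ proj₁) ≡ + 15 * ∑ vertices f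
∑-edges-source f = trans (∑-edges (f ∘ proj₁)) (trans
  (∑-cong-∈ vertices λ {u} u∈ → trans (∑-const (neighbours u) (f u))
    (trans (cong (λ d → f u * + d) (All.lookup regular u∈)) (*-comm (f u) (+ 15))))
  (∑-*ˡ vertices (+ 15) f))

opaque
  unfolding vertices

  -- The edge list is grouped by source, so the degrees at the targets are counted by a separate
  -- evaluation.
  targets-regular : multiple 15 (trie (map proj₂ edges)) (trie vertices) ≡ true
  targets-regular = refl

∑-edges-target : ∀ f → ∑ edges (f ∘ proj₂) ≡ + 15 * ∑ vertices f
∑-edges-target f = trans (sym (∑-map edges proj₂ f))
  (∑-multiple 15 (map proj₂ edges) vertices targets-regular f)

-- Petersen subgraphs and the least eigenvalue of K(10,4).

select : List A → List (A × List A)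
select []       = []
select (x ∷ xs) = (x , xs) ∷ map (λ (y , ys) → y , x ∷ ys) (select xs)

-- The first point left is always matched next, so each perfect matching arises exactly once; ten
-- points have 9 · 7 · 5 · 3 = 945 of them.
matchings : ∀ k → List (Fin 10) → List (Vec (Subset 10) k)
matchings zero    _        = [] ∷ []
matchings (suc k) []       = []
matchings (suc k) (x ∷ xs) =
  concatMap (λ (y , ys) → map ((⁅ x ⁆ ∪ ⁅ y ⁆) ∷_) (matchings k ys)) (select xs)

-- A perfect matching of the ten points turns the 4-sets that are unions of two of its pairs
-- into a copy of the Petersen graph, whose least eigenvalue is −2.
opaque
  petersens : List (Vec (Subset 10) 5)
  petersens = matchings 5 (allFin 10)

duads : List (Fin 5 × Fin 5)
duads = (0F , 1F) ∷ (0F , 2F) ∷ (0F , 3F) ∷ (0F , 4F) ∷ (1F , 2F) ∷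
        (1F , 3F) ∷ (1F , 4F) ∷ (2F , 3F) ∷ (2F , 4F) ∷ (3F , 4F) ∷ []

-- The 15 edges of the Petersen graph, viewed as K(5,2), each in one direction only.
links : List ((Fin 5 × Fin 5) × (Fin 5 × Fin 5))
links = ((0F , 1F) , (2F , 3F)) ∷ ((0F , 1F) , (2F , 4F)) ∷ ((0F , 1F) , (3F , 4F)) ∷
        ((0F , 2F) , (1F , 3F)) ∷ ((0F , 2F) , (1F , 4F)) ∷ ((0F , 2F) , (3F , 4F)) ∷
        ((0F , 3F) , (1F , 2F)) ∷ ((0F , 3F) , (1F , 4F)) ∷ ((0F , 3F) , (2F , 4F)) ∷
        ((0F , 4F) , (1F , 2F)) ∷ ((0F , 4F) , (1F , 3F)) ∷ ((0F , 4F) , (2F , 3F)) ∷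
        ((1F , 2F) , (3F , 4F)) ∷ ((1F , 3F) , (2F , 4F)) ∷ ((1F , 4F) , (2F , 3F)) ∷ []

union : Vec (Subset 10) 5 → Fin 5 × Fin 5 → Subset 10
union p (i , j) = Vec.lookup p i ∪ Vec.lookup p j

petersenVertices : Vec (Subset 10) 5 → List (Subset 10)
petersenVertices p = map (union p) duads

petersenEdges : Vec (Subset 10) 5 → List (Subset 10 × Subset 10)
petersenEdges p = map (λ (d , e) → union p d , union p e) (links ++ map swap links)

opaque
  unfolding vertices petersens

  -- A 4-set splits into two pairs in 3 ways, and the other six points have 15 perfect matchings,
  -- hence 45.
  petersenVertices-uniform :
    multiple 45 (trie (concatMap petersenVertices petersens)) (trie vertices) ≡ true
  petersenVertices-uniform = refl

  -- Each of two disjoint 4-sets splits into pairs in 3 ways, and the remaining two points form the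
  -- fifth pair, hence 9.
  petersenEdges-uniform :
    multiple 9 (trie (map key (concatMap petersenEdges petersens))) (trie (map key edges)) ≡ true
  petersenEdges-uniform = refl

∑-petersenVertices : ∀ f → ∑ petersens (λ p → ∑ (petersenVertices p) f) ≡ + 45 * ∑ vertices f
∑-petersenVertices f = trans (sym (∑-concatMap petersens petersenVertices f))
  (∑-multiple 45 (concatMap petersenVertices petersens) vertices petersenVertices-uniform f)

∑-petersenEdges : ∀ f → ∑ petersens (λ p → ∑ (petersenEdges p) f) ≡ + 9 * ∑ edges f
∑-petersenEdges f = begin
  ∑ petersens (λ p → ∑ (petersenEdges p) f)
    ≡⟨ ∑-concatMap petersens petersenEdges f ⟨
  ∑ (concatMap petersenEdges petersens) f
    ≡⟨ ∑-key (concatMap petersenEdges petersens) f ⟨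
  ∑ (map key (concatMap petersenEdges petersens)) (unkey {10} f)
    ≡⟨ ∑-multiple 9 (map key (concatMap petersenEdges petersens)) (map key edges)
         petersenEdges-uniform (unkey {10} f) ⟩
  + 9 * ∑ (map key edges) (unkey {10} f)
    ≡⟨ cong (+ 9 *_) (∑-key edges f) ⟩
  + 9 * ∑ edges f ∎
  where open ≡-Reasoning

square-nonneg : ∀ x → 0ℤ ≤ x * x
square-nonneg (+ n)    = subst (0ℤ ≤_) (pos-* n n) (+≤+ z≤n)
square-nonneg -[1+ n ] = +≤+ z≤n

-- The last six squares come from the six partitions of the edges of K₅ into two pentagons.
petersen-form : ∀ x01 x02 x03 x04 x12 x13 x14 x23 x24 x34 →
  0ℤ ≤
    + 8 * (x01 * x23 + (x01 * x24 + (x01 * x34 + (x02 * x13 + (x02 * x14 + (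
           x02 * x34 + (x03 * x12 + (x03 * x14 + (x03 * x24 + (x04 * x12 + (
           x04 * x13 + (x04 * x23 + (x12 * x34 + (x13 * x24 + (x14 * x23 + 0ℤ))))))))))))))) +
    + 8 * (x01 * x01 + (x02 * x02 + (x03 * x03 + (x04 * x04 + (x12 * x12 + (
           x13 * x13 + (x14 * x14 + (x23 * x23 + (x24 * x24 + (x34 * x34 + 0ℤ))))))))))
petersen-form x01 x02 x03 x04 x12 x13 x14 x23 x24 x34 =
  (doubled (x01 + x02 + x03 + x04 + x12 + x13 + x14 + x23 + x24 + x34)
   ⊕ ((x01 + x02 + x13 + x24 + x34) - (x03 + x04 + x12 + x14 + x23))
   ⊕ ((x01 + x02 + x14 + x23 + x34) - (x03 + x04 + x12 + x13 + x24))
   ⊕ ((x01 + x03 + x12 + x24 + x34) - (x02 + x04 + x13 + x14 + x23))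
   ⊕ ((x01 + x03 + x14 + x23 + x24) - (x02 + x04 + x12 + x13 + x34))
   ⊕ ((x01 + x04 + x12 + x23 + x34) - (x02 + x03 + x13 + x14 + x24))
   ⊕ ((x01 + x04 + x13 + x23 + x24) - (x02 + x03 + x12 + x14 + x34)))
  ▹ solve (x01 List.∷ x02 List.∷ x03 List.∷ x04 List.∷ x12 List.∷
           x13 List.∷ x14 List.∷ x23 List.∷ x24 List.∷ x34 List.∷ List.[])
  where
  doubled : ∀ x → 0ℤ ≤ + 2 * (x * x)
  doubled x = *-monoˡ-≤-nonNeg (+ 2) (square-nonneg x)
  _⊕_ : ∀ {a} → 0ℤ ≤ a → ∀ x → 0ℤ ≤ a + x * x
  0≤a ⊕ x = +-mono-≤ 0≤a (square-nonneg x)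
  _▹_ : ∀ {a b} → 0ℤ ≤ a → a ≡ b → 0ℤ ≤ b
  0≤a ▹ a≡b = subst (0ℤ ≤_) a≡b 0≤a
  infixl 5 _⊕_
  infix 4 _▹_

petersen-psd : ∀ p (y : Subset 10 → ℤ) →
  0ℤ ≤ ∑ (petersenEdges p) (λ (u , v) → y u * y v) + + 2 * ∑ (petersenVertices p) (λ v → y v * y v)
-- The claim is `+ 2 * L + + 2 * Q`, as `L` takes every edge once; `petersen-form` bounds four times
-- this quantity.
petersen-psd p y = subst (0ℤ ≤_) (sym (cong₂ (λ e q → e + + 2 * q) edgeSum vertexSum))
  (*-cancelˡ-≤-pos 0ℤ (+ 2 * L + + 2 * Q) (+ 4) (subst (0ℤ ≤_) (rescale L Q) nonneg))
  where
  Y : Fin 5 × Fin 5 → ℤ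
  Y d = y (union p d)
  yy : Subset 10 × Subset 10 → ℤ
  yy (u , v) = y u * y v
  YY : (Fin 5 × Fin 5) × (Fin 5 × Fin 5) → ℤ
  YY (d , e) = Y d * Y e
  L Q : ℤ
  L = ∑ links YY
  Q = ∑ duads (λ d → Y d * Y d)
  rescale : ∀ L Q → + 8 * L + + 8 * Q ≡ + 4 * (+ 2 * L + + 2 * Q)
  rescale = solve-∀
  double : ∀ L → L + L ≡ + 2 * L
  double = solve-∀
  vertexSum : ∑ (petersenVertices p) (λ v → y v * y v) ≡ Q
  vertexSum = ∑-map duads (union p) (λ v → y v * y v)
  edgeSum : ∑ (petersenEdges p) (λ (u , v) → y u * y v) ≡ + 2 * L
  edgeSum = begin
    ∑ (petersenEdges p) yy
      ≡⟨ ∑-map (links ++ map swap links) (λ (d , e) → union p d , union p e) yy ⟩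
    ∑ (links ++ map swap links) YY
      ≡⟨ ∑-++ links (map swap links) YY ⟩
    L + ∑ (map swap links) YY
      ≡⟨ cong (_+_ L) (∑-map links swap YY) ⟩
    L + ∑ links (YY ∘ swap)
      ≡⟨ cong (_+_ L) (∑-cong links λ (d , e) → *-comm (Y e) (Y d)) ⟩
    L + L
      ≡⟨ double L ⟩
    + 2 * L ∎
    where open ≡-Reasoning
  nonneg : 0ℤ ≤ + 8 * L + + 8 * Q
  nonneg = petersen-form
    (Y (0F , 1F)) (Y (0F , 2F)) (Y (0F , 3F)) (Y (0F , 4F)) (Y (1F , 2F))
    (Y (1F , 3F)) (Y (1F , 4F)) (Y (2F , 3F)) (Y (2F , 4F)) (Y (3F , 4F))

-- In the sum of the Petersen forms over all matchings each ordered edge counts 9 times and each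
-- square 2 · 45 = 90 times. Dividing by 9 leaves the coefficient 10.
kneser-psd : ∀ (y : Subset 10 → ℤ) →
  0ℤ ≤ ∑ edges (λ (u , v) → y u * y v) + + 10 * ∑ vertices (λ v → y v * y v)
kneser-psd y = *-cancelˡ-≤-pos 0ℤ _ (+ 9) (subst (0ℤ ≤_) sums
  (∑-nonneg petersens (λ p → petersen-psd p y)))
  where
  e : Subset 10 × Subset 10 → ℤ
  e (u , v) = y u * y v
  q : Subset 10 → ℤ
  q v = y v * y v
  regroup : ∀ a b → + 9 * a + + 2 * (+ 45 * b) ≡ + 9 * (a + + 10 * b)
  regroup = solve-∀
  sums : ∑ petersens (λ p → ∑ (petersenEdges p) e + + 2 * ∑ (petersenVertices p) q)
         ≡ + 9 * (∑ edges e + + 10 * ∑ vertices q)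
  sums = begin
    ∑ petersens (λ p → ∑ (petersenEdges p) e + + 2 * ∑ (petersenVertices p) q)
      ≡⟨ ∑-+ petersens _ _ ⟩
    ∑ petersens (λ p → ∑ (petersenEdges p) e) + ∑ petersens (λ p → + 2 * ∑ (petersenVertices p) q)
      ≡⟨ cong₂ _+_ (∑-petersenEdges e)
           (trans (∑-*ˡ petersens (+ 2) _) (cong (+ 2 *_) (∑-petersenVertices q))) ⟩
    + 9 * ∑ edges e + + 2 * (+ 45 * ∑ vertices q)
      ≡⟨ regroup (∑ edges e) (∑ vertices q) ⟩
    + 9 * (∑ edges e + + 10 * ∑ vertices q) ∎
    where open ≡-Reasoning

-- Routes between vertices and an edge isoperimetric inequality.

steps : A → List A → A → List (A × A)
steps u []       x = (u , x) ∷ []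
steps u (m ∷ ms) x = (u , m) ∷ steps m ms x

pairs : List A → List (A × A)
pairs []       = []
pairs (x ∷ xs) = map (x ,_) xs ++ pairs xs

xor-triangle : ∀ a b c → ι (a xor c) ≤ ι (a xor b) + ι (b xor c)
xor-triangle false false c     = ≤-reflexive (sym (+-identityˡ (ι c)))
xor-triangle false true  false = +≤+ z≤n
xor-triangle false true  true  = ≤-refl
xor-triangle true  false false = ≤-refl
xor-triangle true  false true  = +≤+ z≤n
xor-triangle true  true  c     = ≤-reflexive (sym (+-identityˡ (ι (not c))))

separated : (A → Bool) → A × A → ℤ
separated f (u , v) = ι (f u xor f v)

separated-nonneg : ∀ (f : A → Bool) e → 0ℤ ≤ separated f e
separated-nonneg f e = ι-nonneg _

-- If `f` differs at the ends of a walk, it changes along some step.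
separated-steps : ∀ (f : A → Bool) u ms x → separated f (u , x) ≤ ∑ (steps u ms x) (separated f)
separated-steps f u []       x = ≤-reflexive (sym (+-identityʳ _))
separated-steps f u (m ∷ ms) x =
  ≤-trans (xor-triangle (f u) (f m) (f x))
          (+-monoʳ-≤ (separated f (u , m)) (separated-steps f m ms x))

-- Each unordered pair of positions is listed once, so the separated ones correspond to a choice of
-- one entry on either side of `f`.
separated-pairs : ∀ (f : A → Bool) xs →
  ∑ (pairs xs) (separated f) ≡ ∑ xs (ι ∘ f) * ∑ xs (ι ∘ not ∘ f)
separated-pairs f []       = refl
separated-pairs f (x ∷ xs) = trans (∑-++ (map (x ,_) xs) (pairs xs) (separated f))
  (trans (cong₂ _+_ (∑-map xs (x ,_) (separated f)) (separated-pairs f xs)) (first (f x)))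
  where
  S N : ℤ
  S = ∑ xs (ι ∘ f)
  N = ∑ xs (ι ∘ not ∘ f)
  step₁ : ∀ s n → n + s * n ≡ (1ℤ + s) * (0ℤ + n)
  step₁ = solve-∀
  step₂ : ∀ s n → s + s * n ≡ (0ℤ + s) * (1ℤ + n)
  step₂ = solve-∀
  first : ∀ b → ∑ xs (λ y → ι (b xor f y)) + S * N ≡ (ι b + S) * (ι (not b) + N)
  first true  = step₁ S N
  first false = step₂ S N

firstPoint : ∀ {n} → Subset n → Subset n
firstPoint []            = []
firstPoint (inside ∷ s)  = inside ∷ ⊥
firstPoint (outside ∷ s) = outside ∷ firstPoint s

dropPoint : ∀ {n} → Subset n → Subset n
dropPoint []            = []
dropPoint (inside ∷ s)  = outside ∷ s
dropPoint (outside ∷ s) = outside ∷ dropPoint s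

-- The inner vertices of a walk from u to x, where r = ∁ (u ∪ x) has 2 + ∣u ∩ x∣ points.
between : ℕ → Subset 10 → Subset 10 → Subset 10 → List (Subset 10)
between 3 r u x = ((x ∩ ∁ u) ∪ firstPoint r) ∷ ((u ∩ ∁ x) ∪ firstPoint (dropPoint r)) ∷ []
between 4 r u x = r ∷ []
between 5 r u x = dropPoint r ∷ []
between _ r u x = []

route : Subset 10 × Subset 10 → List (Subset 10 × Subset 10)
route (u , x) = let r = ∁ (u ∪ x) in steps u (between ∣ r ∣ r u x) x

opaque
  unfolding vertices

  -- Since `within` fails on a key missing from the second trie, this evaluation also certifies that
  -- every step of every route is an edge.
  route-load :
    within 36 (trie (map key (concatMap route (pairs vertices)))) (trie (map key edges)) ≡ true
  route-load = refl

-- Every separated pair has a separated edge on its route, and the routes together use an ordered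
-- edge at most 36 times.
cut-bound : ∀ f →
  ∑ vertices (ι ∘ f) * ∑ vertices (ι ∘ not ∘ f) ≤ + 36 * ∑ edges (separated f)
cut-bound f = begin
  ∑ vertices (ι ∘ f) * ∑ vertices (ι ∘ not ∘ f)
    ≡⟨ separated-pairs f vertices ⟨
  ∑ (pairs vertices) (separated f)
    ≤⟨ ∑-mono (pairs vertices) separated-route ⟩
  ∑ (pairs vertices) (λ e → ∑ (route e) (separated f))
    ≡⟨ ∑-concatMap (pairs vertices) route (separated f) ⟨
  ∑ routes (separated f)
    ≡⟨ ∑-key routes (separated f) ⟨
  ∑ (map key routes) (unkey {10} (separated f))
    ≤⟨ ∑-within 36 (map key routes) (map key edges) route-load
         (unkey-nonneg {10} (separated f) (separated-nonneg f)) ⟩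
  + 36 * ∑ (map key edges) (unkey {10} (separated f))
    ≡⟨ cong (+ 36 *_) (∑-key edges (separated f)) ⟩
  + 36 * ∑ edges (separated f) ∎
  where
  open ≤-Reasoning
  separated-route : ∀ e → separated f e ≤ ∑ (route e) (separated f)
  separated-route (u , x) = let r = ∁ (u ∪ x) in separated-steps f u (between ∣ r ∣ r u x) x
  routes : List (Subset 10 × Subset 10)
  routes = concatMap route (pairs vertices)

-- Edges inside a class of vertices and edges leaving it.

irreflexive : ∀ {v} → v ∈ vertices → ¬ Adj v v
irreflexive {v} v∈ a = ℕ.0≢1+n (trans (sym (trans (cong ∣_∣ (trans (sym (∩-idem v)) a)) (∣⊥∣≡0 10)))
                                      (∈-vertices⁻ v∈))

*-nonneg : ∀ {a b} → 0ℤ ≤ a → 0ℤ ≤ b → 0ℤ ≤ a * b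
*-nonneg {a} {b} 0≤a 0≤b = *-monoʳ-≤-nonNeg b {{nonNegative 0≤b}} 0≤a

module Part (f : Subset 10 → Bool) where

  size inner : ℤ
  size  = ∑ vertices (ι ∘ f)
  inner = ∑ edges (λ (u , v) → ι (f u) * ι (f v))

  complement-size : ∑ vertices (ι ∘ not ∘ f) ≡ + 210 - size
  complement-size = begin
    N                                 ≡⟨ shift N size ⟩
    (N + size) - size                 ≡⟨ cong (_- size) (∑-+ vertices (ι ∘ not ∘ f) (ι ∘ f)) ⟨
    ∑ vertices (λ v → ι (not (f v)) + ι (f v)) - size
                                      ≡⟨ cong (_- size) (∑-cong vertices (λ v → one (f v))) ⟩
    ∑ vertices (λ _ → 1ℤ) - size      ≡⟨ cong (_- size) (∑-one vertices) ⟩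
    + length vertices - size          ≡⟨ cong (λ n → + n - size) ∣vertices∣ ⟩
    + 210 - size                      ∎
    where
    open ≡-Reasoning
    N : ℤ
    N = ∑ vertices (ι ∘ not ∘ f)
    shift : ∀ a b → a ≡ (a + b) - b
    shift = solve-∀
    one : ∀ b → ι (not b) + ι b ≡ 1ℤ
    one true  = refl
    one false = refl

  -- The indicators a, b of the ends satisfy a xor b = a + b - 2ab, and each end sees degree 15. The
  -- factor 2 is due to an edge leaving the class being listed in both directions.
  cut-size : ∑ edges (separated f) ≡ + 2 * (+ 15 * size - inner)
  cut-size = begin
    ∑ edges (separated f)
      ≡⟨ ∑-cong edges (λ (u , v) → expand (f u) (f v)) ⟩
    ∑ edges (λ (u , v) → (ι (f u) + ι (f v)) + - + 2 * (ι (f u) * ι (f v)))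
      ≡⟨ ∑-+ edges _ _ ⟩
    ∑ edges (λ (u , v) → ι (f u) + ι (f v)) + ∑ edges (λ (u , v) → - + 2 * (ι (f u) * ι (f v)))
      ≡⟨ cong₂ _+_ (∑-+ edges (ι ∘ f ∘ proj₁) (ι ∘ f ∘ proj₂)) (∑-*ˡ edges (- + 2) _) ⟩
    ∑ edges (ι ∘ f ∘ proj₁) + ∑ edges (ι ∘ f ∘ proj₂) + - + 2 * inner
      ≡⟨ cong (λ d → d + - + 2 * inner)
           (cong₂ _+_ (∑-edges-source (ι ∘ f)) (∑-edges-target (ι ∘ f))) ⟩
    + 15 * size + + 15 * size + - + 2 * inner
      ≡⟨ regroup size inner ⟩
    + 2 * (+ 15 * size - inner) ∎
    where
    open ≡-Reasoning
    expand : ∀ a b → ι (a xor b) ≡ (ι a + ι b) + - + 2 * (ι a * ι b)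
    expand true  true  = refl
    expand true  false = refl
    expand false true  = refl
    expand false false = refl
    regroup : ∀ h w → + 15 * h + + 15 * h + - + 2 * w ≡ + 2 * (+ 15 * h - w)
    regroup = solve-∀

  isoperimetry : size * (+ 210 - size) ≤ + 72 * (+ 15 * size - inner)
  isoperimetry = begin
    size * (+ 210 - size)                          ≡⟨ cong (size *_) complement-size ⟨
    size * ∑ vertices (ι ∘ not ∘ f)                ≤⟨ cut-bound f ⟩
    + 36 * ∑ edges (separated f)                   ≡⟨ cong (+ 36 *_) cut-size ⟩
    + 36 * (+ 2 * (+ 15 * size - inner))           ≡⟨ *-assoc (+ 36) (+ 2) _ ⟨
    + 72 * (+ 15 * size - inner)                   ∎
    where open ≤-Reasoning

  -- The graph has no loops, so a vertex of the class has at most `size` - 1 neighbours in the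
  -- class.
  simple : inner + size ≤ size * size
  simple = begin
    inner + size
      ≡⟨ cong (λ w → w + size) (∑-edges _) ⟩
    ∑ vertices (λ u → ∑ (neighbours u) (λ v → ι (f u) * ι (f v))) + size
      ≡⟨ cong (λ w → w + size) (∑-cong vertices λ u → ∑-*ˡ (neighbours u) (ι (f u)) (ι ∘ f)) ⟩
    ∑ vertices (λ u → ι (f u) * ∑ (neighbours u) (ι ∘ f)) + size
      ≡⟨ ∑-+ vertices _ _ ⟨
    ∑ vertices (λ u → ι (f u) * ∑ (neighbours u) (ι ∘ f) + ι (f u))
      ≤⟨ ∑-mono-∈ vertices (λ {u} u∈ → row (f u) (others u∈)) ⟩
    ∑ vertices (λ u → ι (f u) * size)
      ≡⟨ ∑-*ʳ vertices size (ι ∘ f) ⟩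
    size * size ∎
    where
    open ≤-Reasoning
    others : ∀ {u} → u ∈ vertices → ι (f u) + ∑ (neighbours u) (ι ∘ f) ≤ size
    others {u} u∈ = ∑-filter-< (adj? u) (ι-nonneg ∘ f) u∈ (irreflexive u∈)
    row : ∀ b {d} → ι b + d ≤ size → ι b * d + ι b ≤ ι b * size
    row true  {d} le = subst₂ _≤_ (lemma d) (sym (*-identityˡ size)) le
      where
      lemma : ∀ d → 1ℤ + d ≡ 1ℤ * d + 1ℤ
      lemma = solve-∀
    row false     le = ≤-refl

  -- The 15 neighbours of `r` lie outside the class, and 210 - 15 = 195. Later `r` is a vertex of
  -- another component.
  not-everything : ∀ {r} → r ∈ vertices → (∀ {v} → v ∈ neighbours r → f v ≡ false) →
                   size ≤ + 195
  not-everything {r} r∈ off = 0≤i-j⇒j≤i (subst (0ℤ ≤_) (shift size) (i≤j⇒0≤j-i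
    (subst (+ 15 ≤_) complement-size (begin
      + 15                                  ≡⟨ cong +_ (All.lookup regular r∈) ⟨
      + length (neighbours r)               ≡⟨ ∑-one (neighbours r) ⟨
      ∑ (neighbours r) (λ _ → 1ℤ)           ≡⟨ ∑-cong-∈ (neighbours r) (cong (ι ∘ not) ∘ off) ⟨
      ∑ (neighbours r) (ι ∘ not ∘ f)        ≤⟨ ∑-filter-≤ (adj? r) (ι-nonneg ∘ not ∘ f) vertices ⟩
      ∑ vertices (ι ∘ not ∘ f)              ∎))))
    where
    open ≤-Reasoning
    shift : ∀ h → + 210 - h - + 15 ≡ + 195 - h
    shift = solve-∀

  -- Small classes have few inner edges by `simple`; large ones are handled by `isoperimetry`.
  boundary : + 3 ≤ size → size ≤ + 195 → + 38 ≤ + 15 * size - inner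
  boundary 3≤h h≤195 with size ≤? + 13
  -- By `simple` at least h(16 - h) ordered edges leave the class, and h(16 - h) - 39 = (h - 3)(13 -
  -- h). The remaining 1 is 39 - 38.
  ... | yes h≤13 = 0≤i-j⇒j≤i (subst (0ℤ ≤_) (split size inner)
          (+-mono-≤ (+-mono-≤ (*-nonneg (i≤j⇒0≤j-i 3≤h) (i≤j⇒0≤j-i h≤13)) (i≤j⇒0≤j-i simple))
                    (+≤+ (z≤n {1}))))
    where
    split : ∀ h w → (h - + 3) * (+ 13 - h) + (h * h - (w + h)) + 1ℤ ≡ + 15 * h - w - + 38
    split = solve-∀
  -- The product h(210 - h) is symmetric about 105, so on the range from 14 to 196 it is at least 14
  -- · 196 = 72 · 38 + 8.
  ... | no  h≰13 = *-cancelˡ-≤-pos (+ 38) _ (+ 72) (≤-trans big isoperimetry)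
    where
    split : ∀ h → (h - + 14) * (+ 196 - h) + + 8 ≡ h * (+ 210 - h) - + 72 * + 38
    split = solve-∀
    big : + 72 * + 38 ≤ size * (+ 210 - size)
    big = 0≤i-j⇒j≤i (subst (0ℤ ≤_) (split size) (+-mono-≤
      (*-nonneg (i≤j⇒0≤j-i (i<j⇒suc[i]≤j (≰⇒> h≰13)))
                (i≤j⇒0≤j-i (≤-trans h≤195 (+≤+ (ℕ.n≤1+n 195)))))
      (+≤+ (z≤n {8}))))

-- The weighted inequality for the components left by a cut.

-- The label `nothing` marks the cut and `just i` the i-th component. Having at least two labels
-- gives every class a vertex outside it that is not in the cut.
module Labelling {n : ℕ} (ℓ : Subset 10 → Maybe (Fin (2 ℕ.+ n)))
  (closed : ∀ {u v i j} → u ∈ vertices → v ∈ vertices → Adj u v →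
            ℓ u ≡ just i → ℓ v ≡ just j → i ≡ j)
  (inhabited : ∀ i → ∃ λ v → v ∈ vertices × ℓ v ≡ just i)
  where

  c : ℕ
  c = 2 ℕ.+ n

  -- Without opacity `allFin (2 + n)` could unfold to a list with two explicit entries inside the
  -- sums.
  opaque
    labels : List (Fin c)
    labels = allFin c

    ∈-labels : ∀ i → i ∈ labels
    ∈-labels = ∈-allFin

    labels-unique : Unique labels
    labels-unique = Unique.allFin⁺ c

    ∣labels∣ : length labels ≡ c
    ∣labels∣ = length-tabulate id

  is : Fin c → Maybe (Fin c) → Bool
  is i nothing  = false
  is i (just j) = does (i Fin.≟ j)

  is-just : ∀ i → is i (just i) ≡ true
  is-just i = dec-true (i Fin.≟ i) refl

  module Class (i : Fin c) = Part (is i ∘ ℓ)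
  open Class using (size; inner)

  cutSize : ℤ
  cutSize = ∑ vertices (ι ∘ is-nothing ∘ ℓ)

  size≥1 : ∀ i → 1ℤ ≤ size i
  size≥1 i with inhabited i
  ... | v , v∈ , eq = subst (λ b → ι b ≤ size i) (trans (cong (is i) eq) (is-just i))
                        (∑-member (λ u → ι-nonneg (is i (ℓ u))) v∈)

  other : ∀ (i : Fin c) → ∃ λ j → ¬ i ≡ j
  other zero    = suc zero , λ ()
  other (suc i) = zero , λ ()

  size≤195 : ∀ i → size i ≤ + 195
  size≤195 i with other i
  ... | j , i≢j with inhabited j
  ... | r , r∈ , ℓr≡j = Class.not-everything i r∈ λ {v} v∈ → off v∈ (ℓ v) refl
    where
    off : ∀ {v} → v ∈ neighbours r → ∀ m → ℓ v ≡ m → is i m ≡ false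
    off v∈ nothing  _    = refl
    off v∈ (just k) ℓv≡k with ∈-filter⁻ (adj? r) {xs = vertices} v∈
    ... | v∈V , r~v = dec-false (i Fin.≟ k) λ i≡k →
                        i≢j (trans i≡k (sym (closed r∈ v∈V r~v ℓr≡j ℓv≡k)))

  -- Taking the decision as an argument lets the case split in `gain-bound` evaluate `β i` to 5 or
  -- 2.
  weight : ∀ {h} → Dec (h ≤ + 2) → ℤ
  weight (yes _) = + 5
  weight (no _)  = + 2

  β : Fin c → ℤ
  β i = weight (size i ≤? + 2)

  -- This is 100(β - 1)h - β²(w + 10h), expanded into multiples of the four quantities that
  -- `total-gain` sums separately.
  gain : Fin c → ℤ
  gain i = + 100 * (size i * β i) + (- + 100 * size i +
             (- + 1 * (inner i * (β i * β i)) + - + 10 * (size i * (β i * β i))))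

  -- For h ≤ 2 the gain is 150h - 25w, which by `simple` is at least 150 + 100(h - 1), so 150 is
  -- attained for h = 1 only. For h ≥ 3 it is 4(15h - w), at least 4 · 38 = 152 by `boundary`.
  gain-bound : ∀ i → + 150 ≤ gain i × (gain i ≤ + 150 → size i ≡ 1ℤ)
  gain-bound i with size i ≤? + 2
  ... | yes h≤2 = ≤-trans (subst (_≤ + 150 + + 100 * (h - 1ℤ)) (+-identityʳ (+ 150))
                    (+-monoʳ-≤ (+ 150) (*-monoˡ-≤-nonNeg (+ 100) (i≤j⇒0≤j-i (size≥1 i))))) large
                , λ le → ≤-antisym (0≤i-j⇒j≤i (*-cancelˡ-≤-pos 0ℤ (1ℤ - h) (+ 100)
                    (subst (0ℤ ≤_) (flip h) (i≤j⇒0≤j-i (≤-trans large le))))) (size≥1 i)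
    where
    h w g : ℤ
    h = size i
    w = inner i
    g = + 100 * (h * + 5) + (- + 100 * h + (- + 1 * (w * + 25) + - + 10 * (h * + 25)))
    flip : ∀ h → + 150 - (+ 150 + + 100 * (h - 1ℤ)) ≡ + 100 * (1ℤ - h)
    flip = solve-∀
    split : ∀ h w → + 25 * ((h - 1ℤ) * (+ 2 - h)) + + 25 * (h * h - (w + h)) ≡
              + 100 * (h * + 5) + (- + 100 * h + (- + 1 * (w * + 25) + - + 10 * (h * + 25)))
              - (+ 150 + + 100 * (h - 1ℤ))
    split = solve-∀
    large : + 150 + + 100 * (h - 1ℤ) ≤ g
    large = 0≤i-j⇒j≤i (subst (0ℤ ≤_) (split h w) (+-mono-≤
      (*-monoˡ-≤-nonNeg (+ 25) (*-nonneg (i≤j⇒0≤j-i (size≥1 i)) (i≤j⇒0≤j-i h≤2)))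
      (*-monoˡ-≤-nonNeg (+ 25) (i≤j⇒0≤j-i (Class.simple i)))))
  ... | no  h≰2 = ≤-trans (+≤+ (ℕ.m≤m+n 150 2)) large
                , λ le → ⊥-elim (<⇒≱ (+<+ (ℕ.m≤m+n 151 1)) (≤-trans large le))
    where
    h w g : ℤ
    h = size i
    w = inner i
    g = + 100 * (h * + 2) + (- + 100 * h + (- + 1 * (w * + 4) + - + 10 * (h * + 4)))
    split : ∀ h w → + 4 * (+ 15 * h - w) ≡
              + 100 * (h * + 2) + (- + 100 * h + (- + 1 * (w * + 4) + - + 10 * (h * + 4)))
    split = solve-∀
    large : + 152 ≤ g
    large = subst (+ 152 ≤_) (split h w) (*-monoˡ-≤-nonNeg (+ 4)
      (Class.boundary i (i<j⇒suc[i]≤j (≰⇒> h≰2)) (size≤195 i)))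

  at : (Fin c → ℤ) → Maybe (Fin c) → ℤ
  at g nothing  = 0ℤ
  at g (just i) = g i

  ∑-is : ∀ g m → ∑ labels (λ i → ι (is i m) * g i) ≡ at g m
  ∑-is g nothing  = ∑-zero labels
  ∑-is g (just j) = ∑-delta Fin._≟_ g labels-unique (∈-labels j)

  ∑-at : ∀ g → ∑ vertices (at g ∘ ℓ) ≡ ∑ labels (λ i → size i * g i)
  ∑-at g = begin
    ∑ vertices (at g ∘ ℓ)
      ≡⟨ ∑-cong vertices (∑-is g ∘ ℓ) ⟨
    ∑ vertices (λ v → ∑ labels (λ i → ι (is i (ℓ v)) * g i))
      ≡⟨ ∑-swap vertices labels _ ⟩
    ∑ labels (λ i → ∑ vertices (λ v → ι (is i (ℓ v)) * g i))
      ≡⟨ ∑-cong labels (λ i → ∑-*ʳ vertices (g i) (λ v → ι (is i (ℓ v)))) ⟩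
    ∑ labels (λ i → size i * g i) ∎
    where open ≡-Reasoning

  at-square : ∀ g m → at g m * at g m ≡ at (λ i → g i * g i) m
  at-square g nothing  = refl
  at-square g (just i) = refl

  -- With `same` supplied by adjacency, the product is a square on a single class, or zero as soon
  -- as one end is in the cut.
  at-product : ∀ g {l m} → (∀ {i j} → l ≡ just i → m ≡ just j → i ≡ j) →
    at g l * at g m ≡ ∑ labels (λ i → (ι (is i l) * ι (is i m)) * (g i * g i))
  at-product g {nothing} {m} _ = sym (∑-zero labels)
  at-product g {just j} {nothing} _ = trans (*-zeroʳ (g j)) (sym (trans
    (∑-cong labels λ i → cong (_* (g i * g i)) (*-zeroʳ (ι (is i (just j))))) (∑-zero labels)))
  at-product g {just j} {just k} same with same refl refl
  ... | refl = sym (trans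
    (∑-cong labels λ i → cong (_* (g i * g i)) (ι-idem (is i (just j))))
    (∑-is (λ i → g i * g i) (just j)))

  ∑-at-edges : ∀ g → ∑ edges (λ (u , v) → at g (ℓ u) * at g (ℓ v)) ≡
                     ∑ labels (λ i → inner i * (g i * g i))
  ∑-at-edges g = begin
    ∑ edges (λ (u , v) → at g (ℓ u) * at g (ℓ v))
      ≡⟨ ∑-cong-∈ edges (λ e∈ → let (u∈ , v∈ , u~v) = ∈-edges⁻ e∈ in
           at-product g (closed u∈ v∈ u~v)) ⟩
    ∑ edges (λ (u , v) → ∑ labels (λ i → (ι (is i (ℓ u)) * ι (is i (ℓ v))) * (g i * g i)))
      ≡⟨ ∑-swap edges labels _ ⟩
    ∑ labels (λ i → ∑ edges (λ (u , v) → (ι (is i (ℓ u)) * ι (is i (ℓ v))) * (g i * g i)))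
      ≡⟨ ∑-cong labels (λ i → ∑-*ʳ edges (g i * g i)
           (λ (u , v) → ι (is i (ℓ u)) * ι (is i (ℓ v)))) ⟩
    ∑ labels (λ i → inner i * (g i * g i)) ∎
    where open ≡-Reasoning

  cutSize+classes : cutSize + ∑ labels size ≡ + 210
  cutSize+classes = begin
    cutSize + ∑ labels size
      ≡⟨ cong (_+_ cutSize) (∑-cong labels (λ i → *-identityʳ (size i))) ⟨
    cutSize + ∑ labels (λ i → size i * 1ℤ)
      ≡⟨ cong (_+_ cutSize) (∑-at (λ _ → 1ℤ)) ⟨
    cutSize + ∑ vertices (at (λ _ → 1ℤ) ∘ ℓ)
      ≡⟨ ∑-+ vertices (ι ∘ is-nothing ∘ ℓ) (at (λ _ → 1ℤ) ∘ ℓ) ⟨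
    ∑ vertices (λ v → ι (is-nothing (ℓ v)) + at (λ _ → 1ℤ) (ℓ v))
      ≡⟨ ∑-cong vertices (one ∘ ℓ) ⟩
    ∑ vertices (λ _ → 1ℤ)
      ≡⟨ ∑-one vertices ⟩
    + length vertices
      ≡⟨ cong +_ ∣vertices∣ ⟩
    + 210 ∎
    where
    open ≡-Reasoning
    one : ∀ m → ι (is-nothing m) + at (λ _ → 1ℤ) m ≡ 1ℤ
    one nothing  = refl
    one (just i) = refl

  Z Z² W H : ℤ
  Z  = ∑ labels (λ i → size i * β i)
  Z² = ∑ labels (λ i → size i * (β i * β i))
  W  = ∑ labels (λ i → inner i * (β i * β i))
  H  = ∑ labels size

  total-gain : ∑ labels gain ≡ + 100 * Z + (- + 100 * H + (- + 1 * W + - + 10 * Z²))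
  total-gain =
    trans (∑-+ labels _ _) (cong₂ _+_ (∑-*ˡ labels (+ 100) _)
    (trans (∑-+ labels _ _) (cong₂ _+_ (∑-*ˡ labels (- + 100) _)
    (trans (∑-+ labels _ _) (cong₂ _+_ (∑-*ˡ labels (- + 1) _) (∑-*ˡ labels (- + 10) _))))))

  -- This is `kneser-psd` for the test vector `y` below. The constants come from the entries -2: 4
  -- for each of the 15 · 210 ordered edges gives 12600, and 4 for each vertex gives 840.
  spectral : 0ℤ ≤ W + - + 60 * Z + + 12600 + + 10 * (Z² + - + 4 * Z + + 840)
  spectral = subst (0ℤ ≤_) (cong₂ (λ a b → a + + 10 * b) edgePart vertexPart) (kneser-psd y)
    where
    z y : Subset 10 → ℤ
    z v = at β (ℓ v)
    y v = z v - + 2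
    constant : ∀ k → ∑ vertices (λ _ → k) ≡ k * + 210
    constant k = trans (∑-const vertices k) (cong (λ n → k * + n) ∣vertices∣)
    expand : ∀ a b → (a - + 2) * (b - + 2) ≡ a * b + (- + 2 * a + (- + 2 * b + + 4))
    expand = solve-∀
    edgePart : ∑ edges (λ (u , v) → y u * y v) ≡ W + - + 60 * Z + + 12600
    edgePart = begin
      ∑ edges (λ (u , v) → y u * y v)
        ≡⟨ ∑-cong edges (λ (u , v) → expand (z u) (z v)) ⟩
      ∑ edges (λ (u , v) → z u * z v + (- + 2 * z u + (- + 2 * z v + + 4)))
        ≡⟨ trans (∑-+ edges _ _) (cong₂ _+_ (∑-at-edges β)
             (trans (∑-+ edges _ _) (cong₂ _+_ (∑-*ˡ edges (- + 2) (z ∘ proj₁))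
             (trans (∑-+ edges _ _) (cong₂ _+_ (∑-*ˡ edges (- + 2) (z ∘ proj₂)) refl))))) ⟩
      W + (- + 2 * ∑ edges (z ∘ proj₁) + (- + 2 * ∑ edges (z ∘ proj₂) + ∑ edges (λ _ → + 4)))
        ≡⟨ cong (_+_ W) (cong₂ (λ a b → - + 2 * a + b) source
             (cong₂ (λ a b → - + 2 * a + b) target
               (trans (∑-edges-source (λ _ → + 4)) (cong (+ 15 *_) (constant (+ 4)))))) ⟩
      W + (- + 2 * (+ 15 * Z) + (- + 2 * (+ 15 * Z) + + 12600))
        ≡⟨ regroup W Z ⟩
      W + - + 60 * Z + + 12600 ∎
      where
      open ≡-Reasoning
      source = trans (∑-edges-source z) (cong (+ 15 *_) (∑-at β))
      target = trans (∑-edges-target z) (cong (+ 15 *_) (∑-at β))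
      regroup : ∀ w z → w + (- + 2 * (+ 15 * z) + (- + 2 * (+ 15 * z) + + 12600)) ≡
                        w + - + 60 * z + + 12600
      regroup = solve-∀
    vertexPart : ∑ vertices (λ v → y v * y v) ≡ Z² + - + 4 * Z + + 840
    vertexPart = begin
      ∑ vertices (λ v → y v * y v)
        ≡⟨ ∑-cong vertices (λ v → square (z v)) ⟩
      ∑ vertices (λ v → z v * z v + (- + 4 * z v + + 4))
        ≡⟨ trans (∑-+ vertices _ _) (cong₂ _+_ squares
             (trans (∑-+ vertices _ _) (cong₂ _+_ (∑-*ˡ vertices (- + 4) z) (constant (+ 4))))) ⟩
      Z² + (- + 4 * ∑ vertices z + + 840)
        ≡⟨ cong (λ a → Z² + (- + 4 * a + + 840)) (∑-at β) ⟩
      Z² + (- + 4 * Z + + 840)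
        ≡⟨ +-assoc Z² (- + 4 * Z) (+ 840) ⟨
      Z² + - + 4 * Z + + 840 ∎
      where
      open ≡-Reasoning
      square : ∀ a → (a - + 2) * (a - + 2) ≡ a * a + (- + 4 * a + + 4)
      square = solve-∀
      squares : ∑ vertices (λ v → z v * z v) ≡ Z²
      squares = trans (∑-cong vertices (at-square β ∘ ℓ)) (∑-at (λ i → β i * β i))

  -- A rearrangement of `spectral`: 12600 + 10 · 840 = 100 · 210, and 210 - `H` is the size of the
  -- cut.
  total-gain-bound : ∑ labels gain ≤ + 100 * cutSize
  total-gain-bound = 0≤i-j⇒j≤i (subst (0ℤ ≤_) (begin
    W + - + 60 * Z + + 12600 + + 10 * (Z² + - + 4 * Z + + 840)
      ≡⟨ regroup W Z Z² H ⟩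
    + 100 * (+ 210 - H) - (+ 100 * Z + (- + 100 * H + (- + 1 * W + - + 10 * Z²)))
      ≡⟨ cong₂ (λ s g → + 100 * s - g) rest (sym total-gain) ⟩
    + 100 * cutSize - ∑ labels gain ∎) spectral)
    where
    open ≡-Reasoning
    regroup : ∀ W Z Q H → W + - + 60 * Z + + 12600 + + 10 * (Q + - + 4 * Z + + 840) ≡
      + 100 * (+ 210 - H) - (+ 100 * Z + (- + 100 * H + (- + 1 * W + - + 10 * Q)))
    regroup = solve-∀
    cancel : ∀ s h → s + h - h ≡ s
    cancel = solve-∀
    rest : + 210 - H ≡ cutSize
    rest = trans (cong (_- H) (sym cutSize+classes)) (cancel cutSize H)

  -- All terms `gain j - + 150` are nonnegative, so a single one is at most their sum. This yields
  -- both the bound and its equality case.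
  excess : ∀ i → gain i - + 150 ≤ + 50 * (+ 2 * cutSize - + 3 * + c)
  excess i = begin
    gain i - + 150
      ≤⟨ ∑-member (λ j → i≤j⇒0≤j-i (proj₁ (gain-bound j))) (∈-labels i) ⟩
    ∑ labels (λ j → gain j - + 150)
      ≡⟨ ∑-+ labels gain (λ _ → - + 150) ⟩
    ∑ labels gain + ∑ labels (λ _ → - + 150)
      ≡⟨ cong (_+_ (∑ labels gain)) (trans (∑-const labels (- + 150))
           (cong (λ k → - + 150 * + k) ∣labels∣)) ⟩
    ∑ labels gain + - + 150 * + c
      ≤⟨ +-monoˡ-≤ (- + 150 * + c) total-gain-bound ⟩
    + 100 * cutSize + - + 150 * + c
      ≡⟨ regroup cutSize (+ c) ⟩
    + 50 * (+ 2 * cutSize - + 3 * + c) ∎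
    where
    open ≤-Reasoning
    regroup : ∀ s c → + 100 * s + - + 150 * c ≡ + 50 * (+ 2 * s - + 3 * c)
    regroup = solve-∀

  tough : + 3 * + c ≤ + 2 * cutSize
  tough = 0≤i-j⇒j≤i (*-cancelˡ-≤-pos 0ℤ _ (+ 50)
    (≤-trans (i≤j⇒0≤j-i (proj₁ (gain-bound zero))) (excess zero)))

  -- Equality makes the right-hand side of `excess` vanish, so no class gains more than 150.
  tight⇒singletons : + 2 * cutSize ≤ + 3 * + c → ∀ i → size i ≡ 1ℤ
  tight⇒singletons le i = proj₂ (gain-bound i) (i-j≤0⇒i≤j (≤-trans (excess i)
    (*-monoˡ-≤-nonNeg (+ 50) (i≤j⇒i-j≤0 le))))

-- Connectivity, and lists with a condition on all pairs.

adj-sym : ∀ {u v} → Adj u v → Adj v u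
adj-sym {u} {v} a = trans (∩-comm v u) a

remaining-target : ∀ {S u v} → Connected S u v → Remaining S v
remaining-target (here r)     = r
remaining-target (step _ _ r) = r

connected-trans : ∀ {S u v w} → Connected S u v → Connected S v w → Connected S u w
connected-trans p (here _)     = p
connected-trans p (step q a r) = step (connected-trans p q) a r

connected-sym : ∀ {S u v} → Connected S u v → Connected S v u
connected-sym (here r)     = here r
connected-sym (step p a r) =
  -- The last step, reversed, becomes the first step of the walk back.
  connected-trans (step (here r) (adj-sym a) (remaining-target p)) (connected-sym p)

-- `AllPairs` relates earlier entries to later ones only, whence the two alternatives.
lookup-allPairs : ∀ {R : A → A → Set} {xs} → AllPairs R xs → ∀ i j → ¬ i ≡ j →
  R (List.lookup xs i) (List.lookup xs j) ⊎ R (List.lookup xs j) (List.lookup xs i)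
lookup-allPairs (r ∷ rs) zero    zero    i≢j = ⊥-elim (i≢j refl)
lookup-allPairs (r ∷ rs) zero    (suc j) i≢j = inj₁ (All.lookup r (∈-lookup j))
lookup-allPairs (r ∷ rs) (suc i) zero    i≢j = inj₂ (All.lookup r (∈-lookup i))
lookup-allPairs (r ∷ rs) (suc i) (suc j) i≢j = lookup-allPairs rs i j (i≢j ∘ cong suc)

allPairs-∈ : ∀ {R : A → A → Set} {xs} → AllPairs R xs → ∀ {a b} → a ∈ xs → b ∈ xs →
  a ≡ b ⊎ R a b ⊎ R b a
allPairs-∈ (r ∷ rs) (here refl) (here refl) = inj₁ refl
allPairs-∈ (r ∷ rs) (here refl) (there b∈)  = inj₂ (inj₁ (All.lookup r b∈))
allPairs-∈ (r ∷ rs) (there a∈)  (here refl) = inj₂ (inj₂ (All.lookup r a∈))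
allPairs-∈ (r ∷ rs) (there a∈)  (there b∈)  = allPairs-∈ rs a∈ b∈

allPairs-tabulate : ∀ {R : A → A → Set} {xs} → (∀ {a b} → a ∈ xs → b ∈ xs → R a b) → AllPairs R xs
allPairs-tabulate {xs = []}     f = []
allPairs-tabulate {xs = x ∷ xs} f =
  All.tabulate (λ b∈ → f (here refl) (there b∈)) ∷
  allPairs-tabulate (λ a∈ b∈ → f (there a∈) (there b∈))

-- Sizes of vertex sets and of their complements.

length-filter : ∀ {P : A → Set} (P? : Decidable P) xs →
                + length (filter P? xs) ≡ ∑ xs (ι ∘ does ∘ P?)
length-filter P? []       = refl
length-filter P? (x ∷ xs) with does (P? x)
... | true  = cong (_+_ 1ℤ) (length-filter P? xs)
... | false = trans (length-filter P? xs) (sym (+-identityˡ _))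

-- Double counting of the equal pairs of an entry of `S` and a vertex: every entry equals one
-- vertex, and `Unique` lets a vertex occur at most once in `S`.
length-vertexSet : ∀ {S} → IsVertexSet S → + length S ≡ ∑ vertices (λ v → ι (does (v ∈? S)))
length-vertexSet {S} (S⊆V , unique) = begin
  + length S
    ≡⟨ ∑-one S ⟨
  ∑ S (λ _ → 1ℤ)
    ≡⟨ ∑-cong-∈ S (λ {s} s∈ → ∑-delta _≟ₛ_ (λ _ → 1ℤ) vertices-unique
         (∈-vertices⁺ (All.lookup S⊆V s∈))) ⟨
  ∑ S (λ s → ∑ vertices (λ v → ι (does (v ≟ₛ s)) * 1ℤ))
    ≡⟨ ∑-swap S vertices _ ⟩
  ∑ vertices (λ v → ∑ S (λ s → ι (does (v ≟ₛ s)) * 1ℤ))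
    ≡⟨ ∑-cong vertices row ⟩
  ∑ vertices (λ v → ι (does (v ∈? S))) ∎
  where
  open ≡-Reasoning
  does-sym : ∀ u v → does (u ≟ₛ v) ≡ does (v ≟ₛ u)
  does-sym u v with v ≟ₛ u
  ... | yes v≡u = dec-true (u ≟ₛ v) (sym v≡u)
  ... | no  v≢u = dec-false (u ≟ₛ v) (v≢u ∘ sym)
  row : ∀ v → ∑ S (λ s → ι (does (v ≟ₛ s)) * 1ℤ) ≡ ι (does (v ∈? S))
  row v = trans (∑-cong S λ s → cong (λ d → ι d * 1ℤ) (does-sym v s)) (member (v ∈? S))
    where
    member : (v∈? : Dec (v ∈ S)) → ∑ S (λ s → ι (does (s ≟ₛ v)) * 1ℤ) ≡ ι (does v∈?)
    member (yes v∈) = ∑-delta _≟ₛ_ (λ _ → 1ℤ) unique v∈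
    member (no  v∉) = ∑-delta-∉ _≟ₛ_ (λ _ → 1ℤ)
                        (All.tabulate λ {s} s∈ v≡s → v∉ (subst (_∈ S) (sym v≡s) s∈))

complement : List (Subset 10) → List (Subset 10)
complement S = filter (λ v → ¬? (v ∈? S)) vertices

complement-vertexSet : ∀ S → IsVertexSet (complement S)
complement-vertexSet S =
  All.tabulate (λ v∈ → ∈-vertices⁻ (proj₁ (∈-filter⁻ (λ v → ¬? (v ∈? S)) v∈)))
  , Unique.filter⁺ (λ v → ¬? (v ∈? S)) vertices-unique

∈-complement⁻ : ∀ S {v} → v ∈ complement S → v ∉ S
∈-complement⁻ S v∈ = proj₂ (∈-filter⁻ (λ v → ¬? (v ∈? S)) {xs = vertices} v∈)

∈-complement⁺ : ∀ S {v} → IsVertex v → v ∉ S → v ∈ complement S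
∈-complement⁺ S vertex v∉ = ∈-filter⁺ (λ v → ¬? (v ∈? S)) (∈-vertices⁺ vertex) v∉

length-complement : ∀ {S} → IsVertexSet S → length (complement S) ℕ.+ length S ≡ 210
length-complement {S} vs = +-injective (begin
  + (length (complement S) ℕ.+ length S)
    ≡⟨ pos-+ (length (complement S)) (length S) ⟩
  + length (complement S) + + length S
    ≡⟨ cong₂ _+_ (length-filter (λ v → ¬? (v ∈? S)) vertices) (length-vertexSet vs) ⟩
  ∑ vertices (λ v → ι (not (does (v ∈? S)))) + ∑ vertices (λ v → ι (does (v ∈? S)))
    ≡⟨ ∑-+ vertices _ _ ⟨
  ∑ vertices (λ v → ι (not (does (v ∈? S))) + ι (does (v ∈? S)))
    ≡⟨ ∑-cong vertices (λ v → one (does (v ∈? S))) ⟩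
  ∑ vertices (λ _ → 1ℤ)
    ≡⟨ ∑-one vertices ⟩
  + length vertices
    ≡⟨ cong +_ ∣vertices∣ ⟩
  + 210 ∎)
  where
  open ≡-Reasoning
  one : ∀ b → ι (not b) + ι b ≡ 1ℤ
  one true  = refl
  one false = refl

-- Only `J` remains, and no two of its vertices are adjacent, so each is a component and `J` serves
-- as its own list of representatives.
complement-independent-cut : ∀ {J} → IsIndependent J → 2 ℕ.≤ length J →
                             IsCutWith (complement J) (length J)
complement-independent-cut {J} ((J⊆V , unique) , indep) 2≤ =
  complement-vertexSet J , (J , refl , All.tabulate remaining , reps , cover) , 2≤
  where
  remaining : ∀ {v} → v ∈ J → Remaining (complement J) v
  remaining v∈ = All.lookup J⊆V v∈ , λ v∈c → ∈-complement⁻ J v∈c v∈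
  remaining⁻ : ∀ {v} → Remaining (complement J) v → v ∈ J
  remaining⁻ {v} (vertex , v∉c) = decidable-stable (v ∈? J) (v∉c ∘ ∈-complement⁺ J vertex)
  isolated : ∀ {u v} → u ∈ J → v ∈ J → ¬ Adj u v
  isolated u∈ v∈ a with allPairs-∈ indep u∈ v∈
  ... | inj₁ refl      = irreflexive (∈-vertices⁺ (All.lookup J⊆V u∈)) a
  ... | inj₂ (inj₁ ¬a) = ¬a a
  ... | inj₂ (inj₂ ¬a) = ¬a (adj-sym a)
  alone : ∀ {u v} → Connected (complement J) u v → u ≡ v
  alone (here _)     = refl
  alone (step p a r) = ⊥-elim (isolated (remaining⁻ (remaining-target p)) (remaining⁻ r) a)
  reps : AllPairs (λ a b → ¬ Connected (complement J) a b) J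
  reps = AllPairs.map (λ a≢b p → a≢b (alone p)) unique
  cover : ∀ v → Remaining (complement J) v → Any (λ r → Connected (complement J) r v) J
  cover v r = lose (remaining⁻ r) (here r)

-- Components of a cut as labelled classes.

module Cut {n : ℕ} {S : List (Subset 10)} (S-vertexSet : IsVertexSet S)
  (reps : List (Subset 10)) (∣reps∣ : length reps ≡ 2 ℕ.+ n)
  (reps-remain : All (Remaining S) reps)
  (reps-apart : AllPairs (λ a b → ¬ Connected S a b) reps)
  (cover : ∀ v → Remaining S v → Any (λ r → Connected S r v) reps)
  where

  remaining? : ∀ v → Dec (Remaining S v)
  remaining? v = (∣ v ∣ ℕ.≟ 4) ×-dec ¬? (v ∈? S)

  rep : Fin (2 ℕ.+ n) → Subset 10
  rep i = List.lookup reps (Fin.cast (sym ∣reps∣) i)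

  -- The label is the position of the representative chosen by `cover`. With the decision as an
  -- argument, facts about `ℓ` follow by matching on it.
  class : ∀ {v} → Dec (Remaining S v) → Maybe (Fin (2 ℕ.+ n))
  class {v} (yes r) = just (Fin.cast ∣reps∣ (index (cover v r)))
  class     (no _)  = nothing

  ℓ : Subset 10 → Maybe (Fin (2 ℕ.+ n))
  ℓ v = class (remaining? v)

  class-connected : ∀ {v i} (r? : Dec (Remaining S v)) → class r? ≡ just i → Connected S (rep i) v
  class-connected {v} (yes r) refl = subst (λ k → Connected S (List.lookup reps k) v)
    (sym (Fin.cast-involutive (sym ∣reps∣) ∣reps∣ (index (cover v r)))) (lookup-index (cover v r))

  ℓ-connected : ∀ {v i} → ℓ v ≡ just i → Connected S (rep i) v
  ℓ-connected {v} = class-connected (remaining? v)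

  -- A common vertex `v` would join two different representatives, against `reps-apart`.
  rep-injective : ∀ {i j v} → Connected S (rep i) v → Connected S (rep j) v → i ≡ j
  rep-injective {i} {j} p q with i Fin.≟ j
  ... | yes i≡j = i≡j
  ... | no  i≢j = ⊥-elim (apart (lookup-allPairs reps-apart _ _ (i≢j ∘ cast-injective)))
    where
    joined : Connected S (rep i) (rep j)
    joined = connected-trans p (connected-sym q)
    cast-injective : Fin.cast (sym ∣reps∣) i ≡ Fin.cast (sym ∣reps∣) j → i ≡ j
    cast-injective eq = Fin.toℕ-injective (trans (sym (Fin.toℕ-cast (sym ∣reps∣) i))
      (trans (cong Fin.toℕ eq) (Fin.toℕ-cast (sym ∣reps∣) j)))
    apart : ¬ (¬ Connected S (rep i) (rep j) ⊎ ¬ Connected S (rep j) (rep i))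
    apart (inj₁ ¬c) = ¬c joined
    apart (inj₂ ¬c) = ¬c (connected-sym joined)

  closed : ∀ {u v i j} → u ∈ vertices → v ∈ vertices → Adj u v →
           ℓ u ≡ just i → ℓ v ≡ just j → i ≡ j
  closed _ _ a ℓu ℓv =
    rep-injective (step (ℓ-connected ℓu) a (remaining-target (ℓ-connected ℓv))) (ℓ-connected ℓv)

  class-remaining : ∀ {v} (r? : Dec (Remaining S v)) → Remaining S v → ∃ λ i → class r? ≡ just i
  class-remaining (yes r) _ = _ , refl
  class-remaining (no ¬r) r = ⊥-elim (¬r r)

  inhabited : ∀ i → ∃ λ v → v ∈ vertices × ℓ v ≡ just i
  inhabited i = rep i , ∈-vertices⁺ (proj₁ r) , labelled
    where
    r : Remaining S (rep i)
    r = All.lookup reps-remain (∈-lookup (Fin.cast (sym ∣reps∣) i))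
    labelled : ℓ (rep i) ≡ just i
    labelled with class-remaining (remaining? (rep i)) r
    -- The position `j` chosen by `cover` is forced to be `i`, as `rep i` is connected to itself.
    ... | j , eq = trans eq (cong just (rep-injective (ℓ-connected eq) (here r)))

  open Labelling ℓ closed inhabited

  class-nothing : ∀ {v} → IsVertex v → (r? : Dec (Remaining S v)) →
                  is-nothing (class r?) ≡ does (v ∈? S)
  class-nothing {v} vertex (yes (_ , v∉)) = sym (dec-false (v ∈? S) v∉)
  class-nothing {v} vertex (no ¬r)        =
    sym (dec-true (v ∈? S) (decidable-stable (v ∈? S) λ v∉ → ¬r (vertex , v∉)))

  cutSize≡ : cutSize ≡ + length S
  cutSize≡ = trans (∑-cong-∈ vertices λ {v} v∈ →
    cong ι (class-nothing (∈-vertices⁻ v∈) (remaining? v))) (sym (length-vertexSet S-vertexSet))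

  bound : 3 ℕ.* (2 ℕ.+ n) ℕ.≤ 2 ℕ.* length S
  bound = drop‿+≤+ (subst₂ _≤_ (sym (pos-* 3 c))
    (trans (cong (+ 2 *_) cutSize≡) (sym (pos-* 2 (length S)))) tough)

  module Tight (tight : 2 ℕ.* length S ≡ 3 ℕ.* (2 ℕ.+ n)) where

    singletons : ∀ i → Class.size i ≡ 1ℤ
    singletons = tight⇒singletons (≤-reflexive (begin
      + 2 * cutSize         ≡⟨ cong (+ 2 *_) cutSize≡ ⟩
      + 2 * + length S      ≡⟨ pos-* 2 (length S) ⟨
      + (2 ℕ.* length S)    ≡⟨ cong +_ tight ⟩
      + (3 ℕ.* c)           ≡⟨ pos-* 3 c ⟩
      + 3 * + c             ∎))
      where open ≡-Reasoning

    -- Two different vertices with label `i` would contribute 2 to a class of size 1.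
    alone : ∀ {u v i} → u ∈ vertices → v ∈ vertices → ℓ u ≡ just i → ℓ v ≡ just i → u ≡ v
    alone {u} {v} {i} u∈ v∈ ℓu ℓv with u ≟ₛ v
    ... | yes u≡v = u≡v
    ... | no  u≢v = ⊥-elim (<⇒≱ (+<+ (ℕ.n<1+n 1)) (begin
      + 2
        ≡⟨ cong₂ _+_ (∑-delta _≟ₛ_ (λ _ → 1ℤ) vertices-unique u∈)
                     (∑-delta _≟ₛ_ (λ _ → 1ℤ) vertices-unique v∈) ⟨
      ∑ vertices (λ w → ι (does (w ≟ₛ u)) * 1ℤ) + ∑ vertices (λ w → ι (does (w ≟ₛ v)) * 1ℤ)
        ≡⟨ ∑-+ vertices _ _ ⟨
      ∑ vertices (λ w → ι (does (w ≟ₛ u)) * 1ℤ + ι (does (w ≟ₛ v)) * 1ℤ)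
        ≤⟨ ∑-mono vertices (λ w → two (w ≟ₛ u) (w ≟ₛ v)) ⟩
      Class.size i
        ≡⟨ singletons i ⟩
      1ℤ ∎))
      where
      open ≤-Reasoning
      labelled : ∀ {w} → ℓ w ≡ just i → is i (ℓ w) ≡ true
      labelled ℓw = trans (cong (is i) ℓw) (is-just i)
      two : ∀ {w} (p : Dec (w ≡ u)) (q : Dec (w ≡ v)) →
            ι (does p) * 1ℤ + ι (does q) * 1ℤ ≤ ι (is i (ℓ w))
      two (yes refl) (yes u≡v) = ⊥-elim (u≢v u≡v)
      two (yes refl) (no _)    = ≤-reflexive (cong ι (sym (labelled ℓu)))
      two (no _) (yes refl)    = ≤-reflexive (cong ι (sym (labelled ℓv)))
      two (no _) (no _)        = ι-nonneg _

    -- Adjacent remaining vertices share a label by `closed` and hence coincide by `alone`, but no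
    -- vertex is adjacent to itself.
    complement-independent : IsIndependent (complement S)
    complement-independent = complement-vertexSet S , allPairs-tabulate apart
      where
      apart : ∀ {a b} → a ∈ complement S → b ∈ complement S → ¬ Adj a b
      apart {a} {b} a∈ b∈ a~b
        with class-remaining (remaining? a) (vertex a∈ , ∈-complement⁻ S a∈)
           | class-remaining (remaining? b) (vertex b∈ , ∈-complement⁻ S b∈)
        where
        vertex : ∀ {v} → v ∈ complement S → IsVertex v
        vertex v∈ = All.lookup (proj₁ (complement-vertexSet S)) v∈
      ... | i , ℓa | j , ℓb = irreflexive a∈V (subst (Adj a) (sym a≡b) a~b)
        where
        inV : ∀ {v} → v ∈ complement S → v ∈ vertices
        inV v∈ = ∈-vertices⁺ (All.lookup (proj₁ (complement-vertexSet S)) v∈)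
        a∈V : a ∈ vertices
        a∈V = inV a∈
        a≡b : a ≡ b
        a≡b = alone a∈V (inV b∈) ℓa (trans ℓb (cong just (sym (closed a∈V (inV b∈) a~b ℓa ℓb))))

    classes : length S ℕ.+ (2 ℕ.+ n) ≡ 210
    classes = +-injective (begin
      + (length S ℕ.+ c)         ≡⟨ pos-+ (length S) c ⟩
      + length S + + c           ≡⟨ cong₂ _+_ cutSize≡ sizes ⟨
      cutSize + ∑ labels Class.size ≡⟨ cutSize+classes ⟩
      + 210                      ∎)
      where
      open ≡-Reasoning
      sizes : ∑ labels Class.size ≡ + c
      sizes = trans (∑-cong labels singletons) (trans (∑-one labels) (cong +_ ∣labels∣))

    -- Singleton classes give k = c, so 5k = 2k + 3c = 2(k + length of `S`) = 420.
    length-complement≡84 : length (complement S) ≡ 84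
    length-complement≡84 = ℕ.*-cancelˡ-≡ _ 84 5 (begin
      5 ℕ.* k                        ≡⟨ ℕ.*-distribʳ-+ k 2 3 ⟩
      2 ℕ.* k ℕ.+ 3 ℕ.* k            ≡⟨ cong (λ m → 2 ℕ.* k ℕ.+ 3 ℕ.* m) k≡c ⟩
      2 ℕ.* k ℕ.+ 3 ℕ.* c            ≡⟨ cong (2 ℕ.* k ℕ.+_) tight ⟨
      2 ℕ.* k ℕ.+ 2 ℕ.* length S     ≡⟨ ℕ.*-distribˡ-+ 2 k (length S) ⟨
      2 ℕ.* (k ℕ.+ length S)         ≡⟨ cong (2 ℕ.*_) (length-complement S-vertexSet) ⟩
      420                            ∎)
      where
      open ≡-Reasoning
      k : ℕ
      k = length (complement S)
      k≡c : k ≡ c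
      k≡c = ℕ.+-cancelʳ-≡ (length S) k c (trans (length-complement S-vertexSet)
              (trans (sym classes) (ℕ.+-comm (length S) c)))

-- The toughness bound, the independence number and the extremal cut.

toughness-bound : ∀ S c → IsCutWith S c → 3 ℕ.* c ℕ.≤ 2 ℕ.* length S
toughness-bound S (suc (suc n)) (vs , (reps , eq , rem , apart , cover) , _) =
  Cut.bound vs reps eq rem apart cover
toughness-bound S (suc zero) (_ , _ , s≤s ())

-- For the cut that leaves `J`, three times the size of `J` is at most twice that of its complement.
-- Adding twice the size of `J` gives 5 · length `J` ≤ 2 · 210.
independent≤84 : ∀ {J} → IsIndependent J → length J ℕ.≤ 84
independent≤84 {J} indep with 2 ℕ.≤? length J
-- With fewer than two vertices `J` yields no cut, but then the bound is immediate.
... | no  2≰ = ℕ.≤-trans (ℕ.≤-pred (ℕ.≰⇒> 2≰)) (ℕ.m≤m+n 1 83)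
... | yes 2≤ = ℕ.*-cancelˡ-≤ 5 (begin
  5 ℕ.* length J
    ≡⟨ ℕ.*-distribʳ-+ (length J) 3 2 ⟩
  3 ℕ.* length J ℕ.+ 2 ℕ.* length J
    ≤⟨ ℕ.+-monoˡ-≤ (2 ℕ.* length J)
         (toughness-bound _ _ (complement-independent-cut indep 2≤)) ⟩
  2 ℕ.* length (complement J) ℕ.+ 2 ℕ.* length J
    ≡⟨ ℕ.*-distribˡ-+ 2 (length (complement J)) (length J) ⟨
  2 ℕ.* (length (complement J) ℕ.+ length J)
    ≡⟨ cong (2 ℕ.*_) (length-complement (proj₁ indep)) ⟩
  420 ∎)
  where open ℕ.≤-Reasoning

-- The extremal intersecting family of the Erdős-Ko-Rado theorem.
star : ∀ n k → List (Subset (suc n))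
star n k = map (inside ∷_) (subsets n k)

star-unique : ∀ n k → Unique (star n k)
star-unique n k = Unique.map⁺ Vec.∷-injectiveʳ (subsets-unique n k)

∈-star⁻ : ∀ n k {v} → v ∈ star n k → ∃ λ t → ∣ t ∣ ≡ k × v ≡ inside ∷ t
∈-star⁻ n k v∈ with ∈-map⁻ (inside ∷_) v∈
... | t , t∈ , eq = t , subsets-size n k t∈ , eq

star-independent : IsIndependent (star 9 3)
star-independent = (All.tabulate vertex , star-unique 9 3) , allPairs-tabulate meet
  where
  vertex : ∀ {v} → v ∈ star 9 3 → IsVertex v
  vertex v∈ with ∈-star⁻ 9 3 v∈
  ... | t , eq , refl = cong suc eq
  meet : ∀ {a b} → a ∈ star 9 3 → b ∈ star 9 3 → ¬ Adj a b
  meet a∈ b∈ with ∈-star⁻ 9 3 a∈ | ∈-star⁻ 9 3 b∈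
  -- Both sets contain the first point, so the first entry of their intersection is `inside`.
  ... | _ , _ , refl | _ , _ , refl = λ ()

theorem26 :
    ((S : List (Subset 10)) (c : ℕ) → IsCutWith S c → 3 ℕ.* c ℕ.≤ 2 ℕ.* length S)
    × (∃₂ λ (S : List (Subset 10)) (c : ℕ) → IsCutWith S c × 2 ℕ.* length S ≡ 3 ℕ.* c)
    × ((S : List (Subset 10)) (c : ℕ) → IsCutWith S c → 2 ℕ.* length S ≡ 3 ℕ.* c →
        ∃ λ (I : List (Subset 10)) → IsMaxIndependent I × IsComplementOf S I)
theorem26 = toughness-bound , (complement (star 9 3) , 84 , cut , ratio) , maximum
  where
  cut : IsCutWith (complement (star 9 3)) 84
  -- The number of components is `length (star 9 3)`, which evaluates to 84.
  cut = complement-independent-cut star-independent (s≤s (s≤s z≤n))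
  ratio : 2 ℕ.* length (complement (star 9 3)) ≡ 3 ℕ.* 84
  -- The cut has 210 - 84 = 126 vertices, and 2 · 126 = 3 · 84.
  ratio = cong (2 ℕ.*_) (ℕ.+-cancelʳ-≡ 84 (length (complement (star 9 3))) 126
                          (length-complement (proj₁ star-independent)))
  maximum : ∀ S c → IsCutWith S c → 2 ℕ.* length S ≡ 3 ℕ.* c →
            ∃ λ I → IsMaxIndependent I × IsComplementOf S I
  maximum S (suc zero) (_ , _ , s≤s ()) _
  maximum S (suc (suc n)) (vs , (reps , eq , rem , apart , cover) , _) tight =
    complement S
    , (complement-independent
      -- The complement of a tight cut attains the upper bound 84 and is therefore maximum.
      , λ J indep → subst (length J ℕ.≤_) (sym length-complement≡84) (independent≤84 indep))
    , vs
    , λ v vertex → (λ v∈ v∈c → ∈-complement⁻ S v∈c v∈)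
                 , λ v∉c → decidable-stable (v ∈? S) (v∉c ∘ ∈-complement⁺ S vertex)
    where open Cut.Tight vs reps eq rem apart cover tight
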